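{- Let $L(n)$ be either $\mathrm{NC}(n)$ for all $n$, or $\mathrm{Int}(n)$ for all $n$, and let $\mathrm{Kr}L(n)=\{\beta^{\mathrm{Kr}}:\beta\in L(n)\}$. Define, as polynomials in $Y,A,B$, $$m_n=\sum_{\alpha\in\mathrm{Int}(n),\ \beta\in L(n)}Y^{\|\alpha^{ -1}\beta\|}A^{\|\alpha\|}B^{\|\beta\|},\qquad \kappa_n=\sum_{\substack{\alpha\in\mathrm{KrInt}(n),\ \beta\in\mathrm{Kr}L(n)\\ \alpha\wedge_{\mathrm{KrInt}}\beta=0_n}}Y^{\|\alpha^{ -1}\beta\|}A^{\|\alpha^{ -1}\gamma_n\|}B^{\|\beta^{ -1}\gamma_n\|}.$$ Then for every $n\ge1$, $$m_n=\sum_{\sigma\in\mathrm{Int}(n)}\prod_{c\in\sigma}\kappa_{|c|},$$ i.e. $M(X)=\sum_n m_nX^n$ is the boolean transform of $K(X)=\sum_n\kappa_nX^n$ (equivalently $M=K/(1-K)$).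
   Context: $\mathcal S_n$ is the symmetric group on $[n]$; $\#\alpha$ is the number of cycles of $\alpha$ and $\|\alpha\|=n-\#\alpha$. $\gamma_n=(1\,2\,\cdots\,n)$ is the full cycle and $0_n$ the identity permutation. $\mathrm{NC}(n)$ is the set of non-crossing partitions of $[n]$, each identified with the permutation whose cycles are its blocks with elements in increasing order; $\mathrm{Int}(n)\subseteq\mathrm{NC}(n)$ is the set of interval partitions. $\mathrm{NC}(n)$ is ordered by $\rho\le\tau$ iff each block of $\rho$ lies in a block of $\tau$. The Kreweras complement of $\alpha\in\mathrm{NC}(n)$ is $\alpha^{\mathrm{Kr}}=\alpha^{ -1}\gamma_n\in\mathrm{NC}(n)$; $\mathrm{KrInt}(n)=\{\alpha^{\mathrm{Kr}}:\alpha\in\mathrm{Int}(n)\}$. For $\alpha,\beta\in\mathrm{NC}(n)$, $\alpha\wedge_{\mathrm{KrInt}}\beta=\max\{\rho\in\mathrm{KrInt}(n):\rho\le\alpha,\rho\le\beta\}$. The product $\prod_{c\in\sigma}$ runs over blocks of $\sigma$. -}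

module Defs where

open import Function using (id; _∘_)
open import Data.Nat as ℕ using (ℕ; zero; suc; _∸_; _+_)
open import Data.Nat.Properties using (suc-injective)
open import Data.Fin as F using (Fin; zero; suc; toℕ; lower₁)
open import Data.Vec as V using (Vec; []; _∷_; lookup; tabulate)
open import Data.List as L using (List; []; _∷_; [_]; concatMap; map; allFin; foldr; upTo; filterᵇ; length)
open import Data.Bool using (Bool; true; false; _∧_; _∨_; not; if_then_else_)
open import Data.Bool.ListAction using (any; all)
open import Data.Product using (_×_; _,_)
open import Relation.Nullary.Decidable using (⌊_⌋; yes; no)
open import Relation.Binary.PropositionalEquality using (_≡_; sym)

_⇒ᵇ_ : Bool → Bool → Bool
a ⇒ᵇ b = not a ∨ b

eqF : ∀ {n} → Fin n → Fin n → Bool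
eqF i j = ⌊ i F.≟ j ⌋

ltF : ∀ {n} → Fin n → Fin n → Bool
ltF i j = ⌊ toℕ i ℕ.<? toℕ j ⌋

leF : ∀ {n} → Fin n → Fin n → Bool
leF i j = ⌊ toℕ i ℕ.≤? toℕ j ⌋

allF : ∀ {n} → (Fin n → Bool) → Bool
allF {n} p = all p (allFin n)

anyF : ∀ {n} → (Fin n → Bool) → Bool
anyF {n} p = any p (allFin n)

countF : ∀ {n} → (Fin n → Bool) → ℕ
countF {n} p = length (filterᵇ p (allFin n))

leastF : ∀ {n} → (Fin n → Bool) → Fin n → Fin n
leastF {n} p d = foldr (λ i r → if p i then i else r) d (allFin n)

-- Maps [n] → [n] stored as vectors; permutations are the bijective ones.
-- Elements of [n] = {1..n} are represented by Fin n = {0..n-1}.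

Perm : ℕ → Set
Perm n = Vec (Fin n) n

allVecs : ∀ {A : Set} → List A → (k : ℕ) → List (Vec A k)
allVecs xs zero = [ [] ]
allVecs xs (suc k) = concatMap (λ x → map (x ∷_) (allVecs xs k)) xs

allMaps : (n : ℕ) → List (Perm n)
allMaps n = allVecs (allFin n) n

eqPerm : ∀ {n} → Perm n → Perm n → Bool
eqPerm α β = allF (λ i → eqF (lookup α i) (lookup β i))

isBij : ∀ {n} → Perm n → Bool
isBij α = allF (λ i → allF (λ j → eqF (lookup α i) (lookup α j) ⇒ᵇ eqF i j))
        ∧ allF (λ j → anyF (λ i → eqF (lookup α i) j))

_∘ₚ_ : ∀ {n} → Perm n → Perm n → Perm n
α ∘ₚ β = tabulate (λ i → lookup α (lookup β i))

inv : ∀ {n} → Perm n → Perm n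
inv α = tabulate (λ j → leastF (λ i → eqF (lookup α i) j) j)

idP : (n : ℕ) → Perm n
idP n = tabulate id

next : ∀ {n} → Fin n → Fin n
next {suc n} i with toℕ i ℕ.≟ n
... | yes _ = zero
... | no ne = lower₁ (suc i) (λ eq → ne (sym (suc-injective eq)))

γ : (n : ℕ) → Perm n
γ n = tabulate next

iter : ∀ {n} → Perm n → ℕ → Fin n → Fin n
iter α zero i = i
iter α (suc k) i = lookup α (iter α k i)

sameCycle : ∀ {n} → Perm n → Fin n → Fin n → Bool
sameCycle {n} α i j = any (λ k → eqF (iter α k i) j) (upTo n)

isCycleMin : ∀ {n} → Perm n → Fin n → Bool
isCycleMin α i = allF (λ j → sameCycle α i j ⇒ᵇ leF i j)

numCycles : ∀ {n} → Perm n → ℕ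
numCycles α = countF (isCycleMin α)

‖_‖ : ∀ {n} → Perm n → ℕ
‖_‖ {n} α = n ∸ numCycles α

incNext : ∀ {n} → Perm n → Fin n → Fin n
incNext α i =
  if anyF (λ j → sameCycle α i j ∧ ltF i j)
  then leastF (λ j → sameCycle α i j ∧ ltF i j) i
  else leastF (λ j → sameCycle α i j) i

increasingCycles : ∀ {n} → Perm n → Bool
increasingCycles α = allF (λ i → eqF (lookup α i) (incNext α i))

nonCrossing : ∀ {n} → Perm n → Bool
nonCrossing α =
  allF (λ a → allF (λ b → allF (λ c → allF (λ d →
    (ltF a b ∧ ltF b c ∧ ltF c d ∧ sameCycle α a c ∧ sameCycle α b d)
      ⇒ᵇ sameCycle α a b))))

intervalBlocks : ∀ {n} → Perm n → Bool
intervalBlocks α =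
  allF (λ i → allF (λ k → allF (λ j →
    (ltF i k ∧ ltF k j ∧ sameCycle α i j) ⇒ᵇ sameCycle α i k)))

isNC : ∀ {n} → Perm n → Bool
isNC α = isBij α ∧ increasingCycles α ∧ nonCrossing α

isInt : ∀ {n} → Perm n → Bool
isInt α = isNC α ∧ intervalBlocks α

NC : (n : ℕ) → List (Perm n)
NC n = filterᵇ isNC (allMaps n)

Int : (n : ℕ) → List (Perm n)
Int n = filterᵇ isInt (allMaps n)

Kr : ∀ {n} → Perm n → Perm n
Kr {n} α = inv α ∘ₚ γ n

KrInt : (n : ℕ) → List (Perm n)
KrInt n = map Kr (Int n)

_≤ᴾ_ : ∀ {n} → Perm n → Perm n → Bool
ρ ≤ᴾ τ = allF (λ i → allF (λ j → sameCycle ρ i j ⇒ᵇ sameCycle τ i j))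

isMaxOf : ∀ {n} → Perm n → List (Perm n) → Bool
isMaxOf τ S = any (eqPerm τ) S ∧ all (_≤ᴾ τ) S

meetKrIntIsZero : ∀ {n} → Perm n → Perm n → Bool
meetKrIntIsZero {n} α β =
  isMaxOf (idP n) (filterᵇ (λ ρ → (ρ ≤ᴾ α) ∧ (ρ ≤ᴾ β)) (KrInt n))

data LChoice : Set where
  L-NC L-Int : LChoice

Lset : LChoice → (n : ℕ) → List (Perm n)
Lset L-NC  n = NC n
Lset L-Int n = Int n

KrL : LChoice → (n : ℕ) → List (Perm n)
KrL c n = map Kr (Lset c n)

-- Polynomials in Y, A, B with coefficients in ℕ, as multisets (lists up
-- to permutation) of monomials Y^a A^b B^c, stored as (a , b , c).

Poly : Set
Poly = List (ℕ × ℕ × ℕ)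

onePoly : Poly
onePoly = [ (0 , 0 , 0) ]

_*ᴾ_ : Poly → Poly → Poly
p *ᴾ q = concatMap (λ { (a , b , c) →
           map (λ { (a' , b' , c') → (a + a' , b + b' , c + c') }) q }) p

prodᴾ : List Poly → Poly
prodᴾ = foldr _*ᴾ_ onePoly

sumᴾ : List Poly → Poly
sumᴾ = L.concat

m : LChoice → ℕ → Poly
m c n = sumᴾ (concatMap (λ α → map (λ β →
          [ (‖ inv α ∘ₚ β ‖ , ‖ α ‖ , ‖ β ‖) ]) (Lset c n)) (Int n))

κ : LChoice → ℕ → Poly
κ c n = sumᴾ (concatMap (λ α → map (λ β →
          if meetKrIntIsZero α β
          then [ (‖ inv α ∘ₚ β ‖ , ‖ inv α ∘ₚ γ n ‖ , ‖ inv β ∘ₚ γ n ‖) ]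
          else []) (KrL c n)) (KrInt n))

blockSizes : ∀ {n} → Perm n → List ℕ
blockSizes α = map (λ i → countF (sameCycle α i)) (filterᵇ (isCycleMin α) (allFin _))

booleanRHS : LChoice → ℕ → Poly
booleanRHS c n = sumᴾ (map (λ σ → prodᴾ (map (κ c) (blockSizes σ))) (Int n))

-- Write α = α′^Kr and β = β′^Kr in κ. Conjugating by Kreweras complements turns the exponents
-- ‖α⁻¹β‖, ‖α⁻¹γ‖, ‖β⁻¹γ‖ into ‖α′⁻¹β′‖, ‖α′‖, ‖β′‖. For non-crossing α′, the elements k and n lie
-- in the same cycle of α′^Kr exactly when α′ preserves {1,…,k} (a cut at k); the complement of the
-- two-block interval partition with a cut at k is the transposition (k n). Hence the meet is
-- trivial iff α′ and β′ have no common cut, so κ sums over the pairs without a common cut.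
-- Cutting a pair at its first common cut, and an interval partition after its first block, gives
-- the same recursion x(n) = Σ κ(k) x(n-k) for both sides.
module Submission where

open import Defs
open import Data.Bool using (Bool; true; false; T; _∧_; if_then_else_)
open import Data.Bool.Properties using (T-∧; T?)
open import Data.Bool.ListAction using (any; all)
open import Data.Empty using (⊥-elim)
open import Data.Fin as F using (Fin; zero; suc; toℕ; fromℕ; fromℕ<; _↑ˡ_; _↑ʳ_; splitAt)
import Data.Fin.Properties as FP
open import Data.List as L using (List; []; _∷_; allFin; upTo; foldr; filterᵇ; length)
open import Data.List.Membership.Propositional using (_∈_; lose; find)
open import Data.List.Membership.Propositional.Properties using (∈-allFin; ∈-map⁺; ∈-map⁻; ∈-concat⁺′; ∈-concat⁻′; ∈-cartesianProduct⁺; ∈-cartesianProduct⁻; ∈-lookup; ∈-upTo⁺; ∈-cartesianProductWith⁺; ∈-filter⁺; ∈-filter⁻)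
open import Data.List.Relation.Unary.All as All using (All; []; _∷_)
import Data.List.Relation.Unary.All.Properties as AllP
open import Data.List.Relation.Unary.Any as Any using (Any; here; there)
import Data.List.Relation.Unary.Any.Properties as AnyP
open import Data.List.Relation.Unary.AllPairs as AP using (AllPairs; []; _∷_)
import Data.List.Relation.Unary.AllPairs.Properties as APP
open import Data.Nat as ℕ using (ℕ; zero; suc; _+_; _∸_; _≤_; _<_; z≤n; s≤s)
import Data.Nat.Properties as ℕP
open import Data.Nat.Induction using (<-rec)
open import Data.Product using (∃; ∃₂; _×_; _,_; proj₁; proj₂)
open import Data.Sum using (_⊎_; inj₁; inj₂)
open import Data.Vec as V using (Vec; lookup; tabulate)
import Data.Vec.Properties as VP
open import Function using (_∘_; id; Equivalence; mk⇔)
open import Relation.Nullary using (¬_; Dec; does; yes; no; contradiction)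
open import Relation.Nullary.Decidable using (toWitness; fromWitness; map′; _→-dec_; _×-dec_; ¬?)
open import Relation.Binary.PropositionalEquality using (_≡_; _≢_; refl; sym; trans; cong; cong₂; subst; subst₂; module ≡-Reasoning)
open import Data.List.Relation.Unary.Unique.Propositional using (Unique)
import Data.List.Relation.Unary.Unique.Propositional.Properties as UniqueP
import Data.List.Properties as LP
open import Data.List.Membership.Propositional.Properties.WithK using (unique∧set⇒bag)
open import Data.List.Relation.Binary.BagAndSetEquality using (∼bag⇒↭)
open import Data.List.Relation.Binary.Disjoint.Propositional using (Disjoint)
open import Data.List.Relation.Binary.Permutation.Propositional using (_↭_; ↭-refl; ↭-sym; ↭-trans; ↭-reflexive; module PermutationReasoning)
import Data.List.Relation.Binary.Permutation.Propositional.Properties as PermP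
import Data.List.Relation.Binary.Permutation.Propositional as Perm↭

-- Reflection of the Boolean definitions; orbits

-- Kreweras complementation reverses the order of `NC`, so the coarsest proper interval partitions,
-- those with two blocks, become the atoms of `KrInt`. This is why single transpositions detect a
-- nontrivial meet. The criterion itself is obtained by tracing one orbit: under the complement, the
-- last point runs exactly through the last elements of the segments between consecutive cuts. The
-- weight of a pair is multiplicative because inverse, product and norm all respect direct sums. A
-- polynomial is a list up to reordering, and the order in which partitions are enumerated bears no
-- relation to direct sums. The recursion therefore compares duplicate-free lists with the same
-- members. Pairs and interval partitions need the same argument, which is why it is carried out for
-- an abstract `Family`.

T-ext : ∀ {a b} → (T a → T b) → (T b → T a) → a ≡ b
T-ext {true}  {true}  _ _ = refl
T-ext {true}  {false} f _ = ⊥-elim (f _)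
T-ext {false} {true}  _ g = ⊥-elim (g _)
T-ext {false} {false} _ _ = refl

∧-intro : ∀ {a b} → T a → T b → T (a ∧ b)
∧-intro p q = Equivalence.from T-∧ (p , q)

∧-elim : ∀ {a b} → T (a ∧ b) → T a × T b
∧-elim = Equivalence.to T-∧

⇒ᵇ-intro : ∀ {a b} → (T a → T b) → T (a ⇒ᵇ b)
⇒ᵇ-intro {true}  f = f _
⇒ᵇ-intro {false} f = _

⇒ᵇ-elim : ∀ {a b} → T (a ⇒ᵇ b) → T a → T b
⇒ᵇ-elim {true} p _ = p

all-intro : ∀ {A : Set} (p : A → Bool) xs → (∀ {x} → x ∈ xs → T (p x)) → T (all p xs)
all-intro p xs f = AllP.all⁻ p (All.tabulate f)

all-elim : ∀ {A : Set} (p : A → Bool) xs {x} → T (all p xs) → x ∈ xs → T (p x)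
all-elim p xs t x∈ = All.lookup (AllP.all⁺ p xs t) x∈

any-intro : ∀ {A : Set} (p : A → Bool) {xs x} → x ∈ xs → T (p x) → T (any p xs)
any-intro p x∈ t = AnyP.any⁺ p (lose x∈ t)

any-elim : ∀ {A : Set} (p : A → Bool) xs → T (any p xs) → ∃ λ x → x ∈ xs × T (p x)
any-elim p xs t = find (AnyP.any⁻ p xs t)

∈-filterᵇ⁺ : ∀ {A : Set} (p : A → Bool) {x xs} → x ∈ xs → T (p x) → x ∈ filterᵇ p xs
∈-filterᵇ⁺ p = ∈-filter⁺ (T? ∘ p)

∈-filterᵇ⁻ : ∀ {A : Set} (p : A → Bool) {x xs} → x ∈ filterᵇ p xs → x ∈ xs × T (p x)
∈-filterᵇ⁻ p = ∈-filter⁻ (T? ∘ p)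

module _ {n : ℕ} where

  allF-intro : {p : Fin n → Bool} → (∀ i → T (p i)) → T (allF p)
  allF-intro {p} f = all-intro p (allFin n) (λ {x} _ → f x)

  allF-elim : {p : Fin n → Bool} → T (allF p) → ∀ i → T (p i)
  allF-elim {p} t i = all-elim p (allFin n) t (∈-allFin i)

  anyF-intro : {p : Fin n → Bool} → ∀ i → T (p i) → T (anyF p)
  anyF-intro {p} i = any-intro p (∈-allFin i)

  anyF-elim : {p : Fin n → Bool} → T (anyF p) → ∃ λ i → T (p i)
  anyF-elim {p} t with any-elim p (allFin n) t
  ... | i , _ , pi = i , pi

  eqF-intro : {i j : Fin n} → i ≡ j → T (eqF i j)
  eqF-intro {i} {j} = fromWitness {a? = i F.≟ j}

  eqF-elim : {i j : Fin n} → T (eqF i j) → i ≡ j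
  eqF-elim {i} {j} = toWitness {a? = i F.≟ j}

  ltF-intro : {i j : Fin n} → toℕ i < toℕ j → T (ltF i j)
  ltF-intro {i} {j} = fromWitness {a? = toℕ i ℕ.<? toℕ j}

  ltF-elim : {i j : Fin n} → T (ltF i j) → toℕ i < toℕ j
  ltF-elim {i} {j} = toWitness {a? = toℕ i ℕ.<? toℕ j}

  leF-intro : {i j : Fin n} → toℕ i ≤ toℕ j → T (leF i j)
  leF-intro {i} {j} = fromWitness {a? = toℕ i ℕ.≤? toℕ j}

  leF-elim : {i j : Fin n} → T (leF i j) → toℕ i ≤ toℕ j
  leF-elim {i} {j} = toWitness {a? = toℕ i ℕ.≤? toℕ j}

infixl 9 _!_
_!_ : ∀ {n} → Perm n → Fin n → Fin n
_!_ = lookup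

perm-ext : ∀ {n} {α β : Perm n} → (∀ i → α ! i ≡ β ! i) → α ≡ β
perm-ext {α = α} {β} h = begin
  α                   ≡⟨ VP.tabulate∘lookup α ⟨
  tabulate (lookup α) ≡⟨ VP.tabulate-cong h ⟩
  tabulate (lookup β) ≡⟨ VP.tabulate∘lookup β ⟩
  β                   ∎
  where open ≡-Reasoning

Inj : ∀ {n} → Perm n → Set
Inj α = ∀ {i j} → α ! i ≡ α ! j → i ≡ j

-- Forward orbits with no bound on the exponent, unlike `sameCycle`, so that transitivity is
-- addition of exponents.
Reach : ∀ {n} → Perm n → Fin n → Fin n → Set
Reach α i j = ∃ λ k → iter α k i ≡ j

module _ {n : ℕ} (α : Perm n) where

  iter-+ : ∀ p q i → iter α (p + q) i ≡ iter α p (iter α q i)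
  iter-+ zero    q i = refl
  iter-+ (suc p) q i = cong (α !_) (iter-+ p q i)

  Reach-refl : ∀ {i} → Reach α i i
  Reach-refl = 0 , refl

  Reach-step : ∀ i → Reach α i (α ! i)
  Reach-step i = 1 , refl

  Reach-trans : ∀ {i j k} → Reach α i j → Reach α j k → Reach α i k
  Reach-trans {i} (p , refl) (q , refl) = q + p , iter-+ q p i

  Reach-ind : (P : Fin n → Set) → (∀ i → P i → P (α ! i)) → ∀ {i j} → Reach α i j → P i → P j
  Reach-ind P step (zero  , refl) pi = pi
  Reach-ind P step (suc k , refl) pi = step _ (Reach-ind P step (k , refl) pi)

  -- Pigeonhole on the iterates with exponents `0` to `n`: these are `n + 1` values in a set of size
  -- `n`.
  iter-collision : ∀ i → ∃₂ λ a d → suc d + a ≤ n × iter α (suc d + a) i ≡ iter α a i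
  iter-collision i with FP.pigeonhole (ℕP.n<1+n n) (λ k → iter α (toℕ k) i)
  ... | a , b , a<b , eq = toℕ a , toℕ b ∸ suc (toℕ a)
      , subst (_≤ n) (sym lem) (ℕ.s≤s⁻¹ (FP.toℕ<n b))
      , trans (cong (λ z → iter α z i) lem) (sym eq)
    where
    lem : suc (toℕ b ∸ suc (toℕ a)) + toℕ a ≡ toℕ b
    lem = trans (cong (_+ toℕ a) (sym (ℕP.+-∸-assoc 1 a<b))) (ℕP.m∸n+n≡m (ℕP.<⇒≤ a<b))

  -- An exponent of at least `n` runs past the collision, so the loop of length `suc d` can be
  -- removed from it. This justifies the bound `upTo n` in `sameCycle`.
  iter-short : ∀ i k → ∃ λ k′ → k′ < n × iter α k′ i ≡ iter α k i
  iter-short i = <-rec _ step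
    where
    a = proj₁ (iter-collision i)
    d = proj₁ (proj₂ (iter-collision i))
    bound = proj₁ (proj₂ (proj₂ (iter-collision i)))
    coll = proj₂ (proj₂ (proj₂ (iter-collision i)))
    step : ∀ k → (∀ {l} → l < k → ∃ λ k′ → k′ < n × iter α k′ i ≡ iter α l i) →
           ∃ λ k′ → k′ < n × iter α k′ i ≡ iter α k i
    step k rec with k ℕ.<? n
    ... | yes k<n = k , k<n , refl
    ... | no  k≮n = proj₁ shorter , proj₁ (proj₂ shorter) , trans (proj₂ (proj₂ shorter)) same
      where
      r = k ∸ (suc d + a)
      k≡ : r + (suc d + a) ≡ k
      k≡ = ℕP.m∸n+n≡m (ℕP.≤-trans bound (ℕP.≮⇒≥ k≮n))
      r+a<k : r + a < k
      r+a<k = subst (r + a <_) k≡ (ℕP.+-monoʳ-< r (s≤s (ℕP.m≤n+m a d)))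
      shorter = rec r+a<k
      same : iter α (r + a) i ≡ iter α k i
      same = begin
        iter α (r + a) i                  ≡⟨ iter-+ r a i ⟩
        iter α r (iter α a i)             ≡⟨ cong (iter α r) coll ⟨
        iter α r (iter α (suc d + a) i)   ≡⟨ iter-+ r (suc d + a) i ⟨
        iter α (r + (suc d + a)) i        ≡⟨ cong (λ z → iter α z i) k≡ ⟩
        iter α k i                        ∎
        where open ≡-Reasoning

  sameCycle-intro : ∀ {i j} → Reach α i j → T (sameCycle α i j)
  sameCycle-intro {i} {j} (k , eq) with iter-short i k
  ... | k′ , k′<n , eq′ = any-intro (λ l → eqF (iter α l i) j) (∈-upTo⁺ k′<n) (eqF-intro (trans eq′ eq))

  sameCycle-elim : ∀ {i j} → T (sameCycle α i j) → Reach α i j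
  sameCycle-elim {i} {j} t with any-elim (λ l → eqF (iter α l i) j) (upTo n) t
  ... | k , _ , p = k , eqF-elim p

  Reach? : ∀ i j → Dec (Reach α i j)
  Reach? i j = map′ sameCycle-elim sameCycle-intro (T? (sameCycle α i j))

module _ {n : ℕ} (α : Perm n) (α-inj : Inj α) where

  iter-injective : ∀ a {i j} → iter α a i ≡ iter α a j → i ≡ j
  iter-injective zero    eq = eq
  iter-injective (suc a) eq = iter-injective a (α-inj eq)

  -- The collision may occur after a tail of length `a`; injectivity cancels the tail.
  iter-period : ∀ i → ∃ λ d → iter α (suc d) i ≡ i
  iter-period i with iter-collision α i
  ... | a , d , _ , eq = d , iter-injective a (begin
    iter α a (iter α (suc d) i) ≡⟨ iter-+ α a (suc d) i ⟨
    iter α (a + suc d) i        ≡⟨ cong (λ z → iter α z i) (ℕP.+-comm a (suc d)) ⟩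
    iter α (suc d + a) i        ≡⟨ eq ⟩
    iter α a i                  ∎)
    where open ≡-Reasoning

  surjective : ∀ j → ∃ λ i → α ! i ≡ j
  surjective j with iter-period j
  ... | d , eq = iter α d j , eq

  Reach-step⁻ : ∀ i → Reach α (α ! i) i
  Reach-step⁻ i with iter-period i
  ... | d , eq = d , trans (sym (iter-+ α d 1 i)) (trans (cong (λ z → iter α z i) (ℕP.+-comm d 1)) eq)

  Reach-sym : ∀ {i j} → Reach α i j → Reach α j i
  Reach-sym {i} r = Reach-ind α (λ x → Reach α x i) (λ x → Reach-trans α (Reach-step⁻ x)) r (Reach-refl α)

leastF-spec : ∀ {n} (p : Fin n → Bool) d → (∃ λ i → T (p i)) →
              T (p (leastF p d)) × (∀ j → T (p j) → toℕ (leastF p d) ≤ toℕ j)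
leastF-spec {n} p d (i , pi) =
  let least , below = go (allFin n) sorted (i , ∈-allFin i , pi)
  in least , λ j → below j (∈-allFin j)
  where
  sorted : AllPairs (λ i j → toℕ i ≤ toℕ j) (allFin n)
  sorted = APP.tabulate⁺-< (λ i<j → ℕP.<⇒≤ i<j)
  go : ∀ xs → AllPairs (λ i j → toℕ i ≤ toℕ j) xs → (∃ λ i → i ∈ xs × T (p i)) →
       let r = foldr (λ i r → if p i then i else r) d xs in
       T (p r) × (∀ j → j ∈ xs → T (p j) → toℕ r ≤ toℕ j)
  go [] _ (_ , () , _)
  go (x ∷ xs) (x≤ ∷ s) (i , i∈ , pi) with p x in eq
  ... | true  = subst T (sym eq) _ , λ { j (here refl) _ → ℕP.≤-refl ; j (there j∈) _ → All.lookup x≤ j∈ }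
  ... | false with i∈
  ...   | here refl = ⊥-elim (subst T eq pi)
  ...   | there i∈′ =
          let least , below = go xs s (i , i∈′ , pi)
          in least , λ { j (here refl) pj → ⊥-elim (subst T eq pj) ; j (there j∈) pj → below j j∈ pj }

-- Non-crossing and interval permutations

-- The cyclic successor computed by `incNext`, described by order and orbits alone: the next larger
-- element of the orbit or, at its maximum, a return to its minimum. In this form it passes along
-- order embeddings. It determines `y` only among the elements of the orbit.
IncreasingTo : ∀ {n} → Perm n → Fin n → Fin n → Set
IncreasingTo α i y =
    (toℕ i < toℕ y × (∀ j → Reach α i j → toℕ i < toℕ j → toℕ y ≤ toℕ j))
  ⊎ ((∀ j → Reach α i j → toℕ j ≤ toℕ i) × (∀ j → Reach α i j → toℕ y ≤ toℕ j))

incNext-spec : ∀ {n} (α : Perm n) i → Reach α i (incNext α i) × IncreasingTo α i (incNext α i)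
incNext-spec {n} α i with anyF (λ j → sameCycle α i j ∧ ltF i j) in eq
... | true =
  let p = λ j → sameCycle α i j ∧ ltF i j
      pr , below = leastF-spec p i (anyF-elim {p = p} (subst T (sym eq) _))
      r , i<r = ∧-elim pr
  in sameCycle-elim α r
   , inj₁ (ltF-elim i<r , λ j rj i<j → below j (∧-intro (sameCycle-intro α rj) (ltF-intro i<j)))
... | false =
  let pr , below = leastF-spec (sameCycle α i) i (i , sameCycle-intro α (Reach-refl α))
  in sameCycle-elim α pr
   , inj₂ ( (λ j rj → ℕP.≮⇒≥ λ i<j → subst T eq
               (anyF-intro {p = λ j → sameCycle α i j ∧ ltF i j} j (∧-intro (sameCycle-intro α rj) (ltF-intro i<j))))
          , λ j rj → below j (sameCycle-intro α rj))

IncreasingTo-unique : ∀ {n} (α : Perm n) {i x y} → Reach α i x → Reach α i y →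
                      IncreasingTo α i x → IncreasingTo α i y → x ≡ y
IncreasingTo-unique α rx ry (inj₁ (i<x , x≤)) (inj₁ (i<y , y≤)) =
  FP.toℕ-injective (ℕP.≤-antisym (x≤ _ ry i<y) (y≤ _ rx i<x))
IncreasingTo-unique α rx ry (inj₁ (i<x , _)) (inj₂ (≤i , _)) = contradiction (≤i _ rx) (ℕP.<⇒≱ i<x)
IncreasingTo-unique α rx ry (inj₂ (≤i , _)) (inj₁ (i<y , _)) = contradiction (≤i _ ry) (ℕP.<⇒≱ i<y)
IncreasingTo-unique α rx ry (inj₂ (_ , x≤)) (inj₂ (_ , y≤)) =
  FP.toℕ-injective (ℕP.≤-antisym (x≤ _ ry) (y≤ _ rx))

record IsNCPerm {n} (α : Perm n) : Set where
  field
    injective  : Inj α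
    increasing : ∀ i → IncreasingTo α i (α ! i)
    noncrossing : ∀ {a b c d} → toℕ a < toℕ b → toℕ b < toℕ c → toℕ c < toℕ d →
                  Reach α a c → Reach α b d → Reach α a b

Convex : ∀ {n} → Perm n → Set
Convex α = ∀ {i k j} → toℕ i < toℕ k → toℕ k < toℕ j → Reach α i j → Reach α i k

isNC-intro : ∀ {n} (α : Perm n) → IsNCPerm α → T (isNC α)
isNC-intro α nc = ∧-intro
  (∧-intro
    (allF-intro λ i → allF-intro λ j → ⇒ᵇ-intro {a = eqF (α ! i) (α ! j)} λ t → eqF-intro (injective (eqF-elim t)))
    (allF-intro λ j → let i , eq = surjective α injective j in
       anyF-intro {p = λ i → eqF (α ! i) j} i (eqF-intro eq)))
  (∧-intro
    (allF-intro λ i → let r , s = incNext-spec α i in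
       eqF-intro (IncreasingTo-unique α (Reach-step α i) r (increasing i) s))
    (allF-intro λ a → allF-intro λ b → allF-intro λ c → allF-intro λ d →
       ⇒ᵇ-intro {a = ltF a b ∧ ltF b c ∧ ltF c d ∧ sameCycle α a c ∧ sameCycle α b d} λ t →
       let a<b , t = ∧-elim {ltF a b} t
           b<c , t = ∧-elim {ltF b c} t
           c<d , t = ∧-elim {ltF c d} t
           ac , bd = ∧-elim {sameCycle α a c} t
       in sameCycle-intro α (noncrossing (ltF-elim a<b) (ltF-elim b<c) (ltF-elim c<d)
                               (sameCycle-elim α ac) (sameCycle-elim α bd))))
  where open IsNCPerm nc

isNC-elim : ∀ {n} (α : Perm n) → T (isNC α) → IsNCPerm α
isNC-elim α t = record
  { injective   = λ {i} {j} eq → eqF-elim (⇒ᵇ-elim (allF-elim (allF-elim (proj₁ (∧-elim bij)) i) j) (eqF-intro eq))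
  ; increasing  = λ i → subst (IncreasingTo α i) (sym (eqF-elim (allF-elim incr i))) (proj₂ (incNext-spec α i))
  ; noncrossing = λ {a} {b} {c} {d} a<b b<c c<d ac bd → sameCycle-elim α
      (⇒ᵇ-elim (allF-elim (allF-elim (allF-elim (allF-elim cross a) b) c) d)
        (∧-intro (ltF-intro a<b) (∧-intro (ltF-intro b<c) (∧-intro (ltF-intro c<d)
          (∧-intro (sameCycle-intro α ac) (sameCycle-intro α bd))))))
  }
  where
  bij = proj₁ (∧-elim t)
  incr = proj₁ (∧-elim {increasingCycles α} (proj₂ (∧-elim {isBij α} t)))
  cross = proj₂ (∧-elim {increasingCycles α} (proj₂ (∧-elim {isBij α} t)))

InL : LChoice → ∀ {n} → Perm n → Set
InL L-NC  α = IsNCPerm α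
InL L-Int α = IsNCPerm α × Convex α

InL⇒NC : ∀ c {n} {α : Perm n} → InL c α → IsNCPerm α
InL⇒NC L-NC  nc       = nc
InL⇒NC L-Int (nc , _) = nc

-- The enumerations: membership and absence of duplicates

allVecs-cartesian : ∀ {A : Set} (xs : List A) k →
  allVecs xs (suc k) ≡ L.cartesianProductWith V._∷_ xs (allVecs xs k)
allVecs-cartesian {A} xs k = go xs
  where
  go : ∀ ys → L.concatMap (λ x → L.map (x V.∷_) (allVecs xs k)) ys ≡ L.cartesianProductWith V._∷_ ys (allVecs xs k)
  go []       = refl
  go (y ∷ ys) = cong (L.map (y V.∷_) (allVecs xs k) L.++_) (go ys)

∈-allVecs : ∀ {A : Set} (xs : List A) → (∀ x → x ∈ xs) → ∀ {k} (v : Vec A k) → v ∈ allVecs xs k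
∈-allVecs xs all∈ V.[]       = here refl
∈-allVecs xs all∈ (x V.∷ v) = subst (_ ∈_) (sym (allVecs-cartesian xs _))
  (∈-cartesianProductWith⁺ V._∷_ (all∈ x) (∈-allVecs xs all∈ v))

allVecs-unique : ∀ {A : Set} {xs : List A} → Unique xs → ∀ k → Unique (allVecs xs k)
allVecs-unique u zero    = [] ∷ []
allVecs-unique {xs = xs} u (suc k) = subst Unique (sym (allVecs-cartesian xs k))
  (UniqueP.cartesianProductWith⁺ V._∷_ VP.∷-injective u (allVecs-unique u k))

∈-allMaps : ∀ {n} (α : Perm n) → α ∈ allMaps n
∈-allMaps = ∈-allVecs (allFin _) ∈-allFin

Lset-∈⁺ : ∀ c {n} {α : Perm n} → InL c α → α ∈ Lset c n
Lset-∈⁺ L-NC  {α = α} nc = ∈-filterᵇ⁺ isNC (∈-allMaps α) (isNC-intro α nc)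
Lset-∈⁺ L-Int {α = α} (nc , cv) = ∈-filterᵇ⁺ isInt (∈-allMaps α) (∧-intro (isNC-intro α nc)
  (allF-intro λ i → allF-intro λ k → allF-intro λ j →
    ⇒ᵇ-intro {a = ltF i k ∧ ltF k j ∧ sameCycle α i j} λ t →
    let i<k , t = ∧-elim {ltF i k} t
        k<j , r = ∧-elim {ltF k j} t
    in sameCycle-intro α (cv (ltF-elim i<k) (ltF-elim k<j) (sameCycle-elim α r))))

Lset-∈⁻ : ∀ c {n} {α : Perm n} → α ∈ Lset c n → InL c α
Lset-∈⁻ L-NC  {α = α} α∈ = isNC-elim α (proj₂ (∈-filterᵇ⁻ isNC {xs = allMaps _} α∈))
Lset-∈⁻ L-Int {α = α} α∈ =
  let nc , t = ∧-elim {isNC α} (proj₂ (∈-filterᵇ⁻ isInt {xs = allMaps _} α∈))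
  in isNC-elim α nc
   , λ {i} {k} {j} i<k k<j r → sameCycle-elim α
       (⇒ᵇ-elim (allF-elim (allF-elim (allF-elim t i) k) j)
         (∧-intro (ltF-intro i<k) (∧-intro (ltF-intro k<j) (sameCycle-intro α r))))

Lset-unique : ∀ c n → Unique (Lset c n)
Lset-unique L-NC  n = UniqueP.filter⁺ (T? ∘ isNC) (allVecs-unique (UniqueP.allFin⁺ n) n)
Lset-unique L-Int n = UniqueP.filter⁺ (T? ∘ isInt) (allVecs-unique (UniqueP.allFin⁺ n) n)

-- Direct sums and cuts

-- What the two summands of a direct sum have in common: an order-preserving, equivariant inclusion
-- with convex image. By `comm` the image is closed under `π`, so orbits in it are exactly images of
-- orbits of `α`.
record Embed {a b} (α : Perm a) (π : Perm b) : Set where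
  field
    e      : Fin a → Fin b
    e-<    : ∀ {i j} → toℕ i < toℕ j → toℕ (e i) < toℕ (e j)
    convex : ∀ {i j x} → toℕ (e i) < toℕ x → toℕ x < toℕ (e j) → ∃ λ y → x ≡ e y
    comm   : ∀ i → π ! e i ≡ e (α ! i)

  e-≤⁻ : ∀ {i j} → toℕ (e i) ≤ toℕ (e j) → toℕ i ≤ toℕ j
  e-≤⁻ le = ℕP.≮⇒≥ λ lt → ℕP.<⇒≱ (e-< lt) le

  e-injective : ∀ {i j} → e i ≡ e j → i ≡ j
  e-injective eq = FP.toℕ-injective
    (ℕP.≤-antisym (e-≤⁻ (ℕP.≤-reflexive (cong toℕ eq))) (e-≤⁻ (ℕP.≤-reflexive (cong toℕ (sym eq)))))

  e-≤ : ∀ {i j} → toℕ i ≤ toℕ j → toℕ (e i) ≤ toℕ (e j)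
  e-≤ {i} {j} le with ℕP.m≤n⇒m<n∨m≡n le
  ... | inj₁ lt = ℕP.<⇒≤ (e-< lt)
  ... | inj₂ eq = ℕP.≤-reflexive (cong (toℕ ∘ e) (FP.toℕ-injective eq))

  e-<⁻ : ∀ {i j} → toℕ (e i) < toℕ (e j) → toℕ i < toℕ j
  e-<⁻ lt = ℕP.≰⇒> λ le → ℕP.<⇒≱ lt (e-≤ le)

  e-iter : ∀ k i → iter π k (e i) ≡ e (iter α k i)
  e-iter zero    i = refl
  e-iter (suc k) i = trans (cong (π !_) (e-iter k i)) (comm _)

  reach⁺ : ∀ {i j} → Reach α i j → Reach π (e i) (e j)
  reach⁺ (k , refl) = k , e-iter k _

  reach-image : ∀ {i y} → Reach π (e i) y → ∃ λ j → y ≡ e j × Reach α i j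
  reach-image (k , refl) = _ , e-iter k _ , k , refl

  reach⁻ : ∀ {i j} → Reach π (e i) (e j) → Reach α i j
  reach⁻ (k , eq) = k , e-injective (trans (sym (e-iter k _)) eq)

  increasing⁺ : ∀ {i} → IncreasingTo α i (α ! i) → IncreasingTo π (e i) (π ! e i)
  increasing⁺ {i} h rewrite comm i with h
  ... | inj₁ (lt , least) = inj₁ (e-< lt , λ j r i<j → let j′ , eq , r′ = reach-image r in
          subst (λ z → _ ≤ toℕ z) (sym eq) (e-≤ (least j′ r′ (e-<⁻ (subst (λ z → _ < toℕ z) eq i<j)))))
  ... | inj₂ (top , least) = inj₂
          ( (λ j r → let j′ , eq , r′ = reach-image r in subst (λ z → toℕ z ≤ _) (sym eq) (e-≤ (top j′ r′)))
          , (λ j r → let j′ , eq , r′ = reach-image r in subst (λ z → _ ≤ toℕ z) (sym eq) (e-≤ (least j′ r′))))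

  increasing⁻ : ∀ {i} → IncreasingTo π (e i) (π ! e i) → IncreasingTo α i (α ! i)
  increasing⁻ {i} h rewrite comm i with h
  ... | inj₁ (lt , least) = inj₁ (e-<⁻ lt , λ j r i<j → e-≤⁻ (least (e j) (reach⁺ r) (e-< i<j)))
  ... | inj₂ (top , least) = inj₂
          ((λ j r → e-≤⁻ (top (e j) (reach⁺ r))) , (λ j r → e-≤⁻ (least (e j) (reach⁺ r))))

  injective⁻ : Inj π → Inj α
  injective⁻ inj eq = e-injective (inj (trans (comm _) (trans (cong e eq) (sym (comm _)))))

  nc⁻ : IsNCPerm π → IsNCPerm α
  nc⁻ nc = record
    { injective   = injective⁻ injective
    ; increasing  = λ i → increasing⁻ (increasing (e i))
    ; noncrossing = λ a<b b<c c<d ac bd →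
        reach⁻ (noncrossing (e-< a<b) (e-< b<c) (e-< c<d) (reach⁺ ac) (reach⁺ bd))
    }
    where open IsNCPerm nc

  inL⁻ : ∀ c → InL c π → InL c α
  inL⁻ L-NC  nc        = nc⁻ nc
  inL⁻ L-Int (nc , cv) = nc⁻ nc , λ i<k k<j r → reach⁻ (cv (e-< i<k) (e-< k<j) (reach⁺ r))

  isCycleMin-e : ∀ i → isCycleMin π (e i) ≡ isCycleMin α i
  isCycleMin-e i = T-ext
    (λ t → allF-intro λ j → ⇒ᵇ-intro {a = sameCycle α i j} λ s →
      leF-intro (e-≤⁻ (leF-elim (⇒ᵇ-elim (allF-elim t (e j))
        (sameCycle-intro π (reach⁺ (sameCycle-elim α s)))))))
    (λ t → allF-intro λ y → ⇒ᵇ-intro {a = sameCycle π (e i) y} λ s →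
      let j , eq , r = reach-image (sameCycle-elim π s)
      in leF-intro (subst (λ z → _ ≤ toℕ z) (sym eq)
           (e-≤ (leF-elim (⇒ᵇ-elim (allF-elim t j) (sameCycle-intro α r))))))

  sameCycle-e : ∀ i j → sameCycle π (e i) (e j) ≡ sameCycle α i j
  sameCycle-e i j = T-ext
    (λ s → sameCycle-intro α (reach⁻ (sameCycle-elim π s)))
    (λ s → sameCycle-intro π (reach⁺ (sameCycle-elim α s)))

infixr 6 _⊕_
_⊕_ : ∀ {k l} → Perm k → Perm l → Perm (k + l)
_⊕_ {k} {l} α β = V.map (_↑ˡ l) α V.++ V.map (k ↑ʳ_) β

data Side {k l} : Fin (k + l) → Set where
  left  : ∀ i → Side (i ↑ˡ l)
  right : ∀ j → Side (k ↑ʳ j)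

side : ∀ k {l} (x : Fin (k + l)) → Side {k} {l} x
side k {l} x with splitAt k x in eq
... | inj₁ i = subst Side (FP.splitAt⁻¹-↑ˡ eq) (left i)
... | inj₂ j = subst Side (FP.splitAt⁻¹-↑ʳ {k} eq) (right j)

↑ˡ<k : ∀ {k} l (i : Fin k) → toℕ (i ↑ˡ l) < k
↑ˡ<k l i = subst (_< _) (sym (FP.toℕ-↑ˡ i l)) (FP.toℕ<n i)

k≤↑ʳ : ∀ k {l} (j : Fin l) → k ≤ toℕ (k ↑ʳ j)
k≤↑ʳ k j = subst (k ≤_) (sym (FP.toℕ-↑ʳ k j)) (ℕP.m≤m+n k (toℕ j))

below⇒↑ˡ : ∀ {k l} (x : Fin (k + l)) → toℕ x < k → ∃ λ i → x ≡ i ↑ˡ l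
below⇒↑ˡ {k} {l} x x<k with side k {l} x
... | left i  = i , refl
... | right j = contradiction (k≤↑ʳ k j) (ℕP.<⇒≱ x<k)

above⇒↑ʳ : ∀ {k l} (x : Fin (k + l)) → k ≤ toℕ x → ∃ λ j → x ≡ k ↑ʳ j
above⇒↑ʳ {k} {l} x k≤x with side k {l} x
... | left i  = contradiction k≤x (ℕP.<⇒≱ (↑ˡ<k l i))
... | right j = j , refl

module _ {k l} (α : Perm k) (β : Perm l) where

  ⊕-ˡ : ∀ i → (α ⊕ β) ! (i ↑ˡ l) ≡ (α ! i) ↑ˡ l
  ⊕-ˡ i = trans (VP.lookup-++ˡ (V.map (_↑ˡ l) α) _ i) (VP.lookup-map i (_↑ˡ l) α)

  ⊕-ʳ : ∀ j → (α ⊕ β) ! (k ↑ʳ j) ≡ k ↑ʳ (β ! j)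
  ⊕-ʳ j = trans (VP.lookup-++ʳ (V.map (_↑ˡ l) α) _ j) (VP.lookup-map j (k ↑ʳ_) β)

  embedˡ : Embed α (α ⊕ β)
  embedˡ = record
    { e      = _↑ˡ l
    ; e-<    = λ {i} {j} lt → subst₂ _<_ (sym (FP.toℕ-↑ˡ i l)) (sym (FP.toℕ-↑ˡ j l)) lt
    ; convex = λ {i} {j} {x} _ lt → below⇒↑ˡ x (ℕP.<-trans lt (↑ˡ<k l j))
    ; comm   = ⊕-ˡ
    }

  embedʳ : Embed β (α ⊕ β)
  embedʳ = record
    { e      = k ↑ʳ_
    ; e-<    = λ {i} {j} lt → subst₂ _<_ (sym (FP.toℕ-↑ʳ k i)) (sym (FP.toℕ-↑ʳ k j)) (ℕP.+-monoʳ-< k lt)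
    ; convex = λ {i} {j} {x} lt _ → above⇒↑ʳ x (ℕP.≤-trans (k≤↑ʳ k i) (ℕP.<⇒≤ lt))
    ; comm   = ⊕-ʳ
    }

  private
    module Eˡ = Embed embedˡ
    module Eʳ = Embed embedʳ

  ˡ≢ʳ : ∀ {i : Fin k} {j : Fin l} → i ↑ˡ l ≢ k ↑ʳ j
  ˡ≢ʳ {i} {j} eq = ℕP.<⇒≱ (subst (λ z → toℕ z < k) eq (↑ˡ<k l i)) (k≤↑ʳ k j)

  ⊕-Inj : Inj α → Inj β → Inj (α ⊕ β)
  ⊕-Inj α-inj β-inj {x} {y} eq with side k {l} x | side k {l} y
  ... | left i  | left j  = cong (_↑ˡ l) (α-inj (Eˡ.e-injective (trans (sym (⊕-ˡ i)) (trans eq (⊕-ˡ j)))))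
  ... | left i  | right j = contradiction (trans (sym (⊕-ˡ i)) (trans eq (⊕-ʳ j))) ˡ≢ʳ
  ... | right i | left j  = contradiction (trans (sym (⊕-ˡ j)) (trans (sym eq) (⊕-ʳ i))) ˡ≢ʳ
  ... | right i | right j = cong (k ↑ʳ_) (β-inj (Eʳ.e-injective (trans (sym (⊕-ʳ i)) (trans eq (⊕-ʳ j)))))

  ⊕-NC⁺ : IsNCPerm α → IsNCPerm β → IsNCPerm (α ⊕ β)
  ⊕-NC⁺ ncα ncβ = record
    { injective   = ⊕-Inj A.injective B.injective
    ; increasing  = incr
    ; noncrossing = cross
    }
    where
    module A = IsNCPerm ncα
    module B = IsNCPerm ncβ
    incr : ∀ x → IncreasingTo (α ⊕ β) x ((α ⊕ β) ! x)
    incr x with side k {l} x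
    ... | left i  = Eˡ.increasing⁺ (A.increasing i)
    ... | right j = Eʳ.increasing⁺ (B.increasing j)
    lift : ∀ {m} {σ : Perm m} → IsNCPerm σ → (em : Embed σ (α ⊕ β)) → let open Embed em in
           ∀ {a} {b c d : Fin (k + l)} → toℕ (e a) < toℕ b → toℕ b < toℕ c → toℕ c < toℕ d →
           Reach (α ⊕ β) (e a) c → Reach (α ⊕ β) b d → Reach (α ⊕ β) (e a) b
    -- All four points fall into one summand: `c` lies in the orbit of `a`, `b` between `a` and `c`,
    -- and `d` in the orbit of `b`.
    lift ncσ em a<b b<c c<d ac bd with Embed.reach-image em ac
    ... | c , refl , ac′ with Embed.convex em a<b b<c
    ... | b , refl with Embed.reach-image em bd
    ... | d , refl , bd′ =
      reach⁺ (IsNCPerm.noncrossing ncσ (e-<⁻ a<b) (e-<⁻ b<c) (e-<⁻ c<d) ac′ bd′)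
      where open Embed em
    cross : ∀ {a b c d} → toℕ a < toℕ b → toℕ b < toℕ c → toℕ c < toℕ d →
            Reach (α ⊕ β) a c → Reach (α ⊕ β) b d → Reach (α ⊕ β) a b
    cross {a} with side k {l} a
    ... | left i  = lift ncα embedˡ
    ... | right j = lift ncβ embedʳ

  ⊕-Convex⁺ : Convex α → Convex β → Convex (α ⊕ β)
  ⊕-Convex⁺ cvα cvβ {i} = go i
    where
    lift : ∀ {m} {σ : Perm m} → Convex σ → (em : Embed σ (α ⊕ β)) → let open Embed em in
           ∀ {i} {j h : Fin (k + l)} → toℕ (e i) < toℕ j → toℕ j < toℕ h →
           Reach (α ⊕ β) (e i) h → Reach (α ⊕ β) (e i) j
    lift cv em i<j j<h r with Embed.reach-image em r
    ... | h , refl , r′ with Embed.convex em i<j j<h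
    ... | j , refl = Embed.reach⁺ em (cv (Embed.e-<⁻ em i<j) (Embed.e-<⁻ em j<h) r′)
    go : ∀ i {j h : Fin (k + l)} → toℕ i < toℕ j → toℕ j < toℕ h →
         Reach (α ⊕ β) i h → Reach (α ⊕ β) i j
    go i with side k {l} i
    ... | left _  = lift cvα embedˡ
    ... | right _ = lift cvβ embedʳ

  ⊕-InL⁺ : ∀ c → InL c α → InL c β → InL c (α ⊕ β)
  ⊕-InL⁺ L-NC  a         b         = ⊕-NC⁺ a b
  ⊕-InL⁺ L-Int (a , cvα) (b , cvβ) = ⊕-NC⁺ a b , ⊕-Convex⁺ cvα cvβ

  ⊕-InL⁻ : ∀ c → InL c (α ⊕ β) → InL c α × InL c β
  ⊕-InL⁻ c h = Eˡ.inL⁻ c h , Eʳ.inL⁻ c h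

⊕-injective : ∀ {k l} {α α′ : Perm k} {β β′ : Perm l} → α ⊕ β ≡ α′ ⊕ β′ → α ≡ α′ × β ≡ β′
⊕-injective {k} {l} {α} {α′} {β} {β′} eq =
    perm-ext (λ i → Embed.e-injective (embedˡ α β)
      (trans (sym (⊕-ˡ α β i)) (trans (cong (_! (i ↑ˡ l)) eq) (⊕-ˡ α′ β′ i))))
  , perm-ext (λ j → Embed.e-injective (embedʳ α β)
      (trans (sym (⊕-ʳ α β j)) (trans (cong (_! (k ↑ʳ j)) eq) (⊕-ʳ α′ β′ j))))

-- The second half makes the final segment invariant as well; `Cut-split` reads the second summand
-- off it.
Cut : ∀ {n} → Perm n → ℕ → Set
Cut α k = ∀ i → (toℕ i < k → toℕ (α ! i) < k) × (toℕ (α ! i) < k → toℕ i < k)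

Cut? : ∀ {n} (α : Perm n) k → Dec (Cut α k)
Cut? α k = FP.all? λ i → ((toℕ i ℕ.<? k) →-dec (toℕ (α ! i) ℕ.<? k))
                  ×-dec ((toℕ (α ! i) ℕ.<? k) →-dec (toℕ i ℕ.<? k))

Cut-end : ∀ {n} (α : Perm n) → Cut α n
Cut-end α i = (λ _ → FP.toℕ<n (α ! i)) , (λ _ → FP.toℕ<n i)

module _ {n} {α : Perm n} {k} (cut : Cut α k) where

  Cut-reach⁺ : ∀ {i j} → Reach α i j → toℕ i < k → toℕ j < k
  Cut-reach⁺ = Reach-ind α (λ x → toℕ x < k) (λ x → proj₁ (cut x))

  Cut-reach⁻ : ∀ {i j} → Reach α i j → k ≤ toℕ i → k ≤ toℕ j
  Cut-reach⁻ = Reach-ind α (λ x → k ≤ toℕ x) (λ x k≤x → ℕP.≮⇒≥ λ lt → ℕP.<⇒≱ (proj₂ (cut x) lt) k≤x)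

module _ {k l} (α : Perm k) (β : Perm l) {j} (j≤k : j ≤ k) where

  Cut-⊕⁺ : Cut α j → Cut (α ⊕ β) j
  Cut-⊕⁺ cut x with side k {l} x
  ... | left i rewrite ⊕-ˡ α β i | FP.toℕ-↑ˡ i l | FP.toℕ-↑ˡ (α ! i) l = cut i
  ... | right i rewrite ⊕-ʳ α β i =
      (λ lt → contradiction (ℕP.≤-trans j≤k (k≤↑ʳ k i)) (ℕP.<⇒≱ lt))
    , (λ lt → contradiction (ℕP.≤-trans j≤k (k≤↑ʳ k (β ! i))) (ℕP.<⇒≱ lt))

  Cut-⊕⁻ : Cut (α ⊕ β) j → Cut α j
  Cut-⊕⁻ cut i with cut (i ↑ˡ l)
  ... | c rewrite ⊕-ˡ α β i | FP.toℕ-↑ˡ i l | FP.toℕ-↑ˡ (α ! i) l = c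

Cut-split : ∀ {k l} (π : Perm (k + l)) → Cut π k → ∃₂ λ α β → π ≡ α ⊕ β
Cut-split {k} {l} π cut = α , β , perm-ext same
  where
  lo : ∀ i → ∃ λ i′ → π ! (i ↑ˡ l) ≡ i′ ↑ˡ l
  lo i = below⇒↑ˡ _ (proj₁ (cut (i ↑ˡ l)) (↑ˡ<k l i))
  hi : ∀ j → ∃ λ j′ → π ! (k ↑ʳ j) ≡ k ↑ʳ j′
  hi j = above⇒↑ʳ _ (ℕP.≮⇒≥ λ lt → ℕP.<⇒≱ (proj₂ (cut (k ↑ʳ j)) lt) (k≤↑ʳ k j))
  α : Perm k
  α = tabulate (proj₁ ∘ lo)
  β : Perm l
  β = tabulate (proj₁ ∘ hi)
  same : ∀ x → π ! x ≡ (α ⊕ β) ! x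
  same x with side k {l} x
  ... | left i  = trans (proj₂ (lo i)) (sym (trans (⊕-ˡ α β i) (cong (_↑ˡ l) (VP.lookup∘tabulate _ i))))
  ... | right j = trans (proj₂ (hi j)) (sym (trans (⊕-ʳ α β j) (cong (k ↑ʳ_) (VP.lookup∘tabulate _ j))))

-- Cycle counts, inverses and conjugation

allFin-+ : ∀ k l → allFin (k + l) ≡ L.map (_↑ˡ l) (allFin k) L.++ L.map (k ↑ʳ_) (allFin l)
allFin-+ zero    l = sym (LP.map-id (allFin l))
allFin-+ (suc k) l = cong (zero ∷_) (begin
  L.tabulate suc
    ≡⟨ LP.map-tabulate id suc ⟨
  L.map suc (allFin (k + l))
    ≡⟨ cong (L.map suc) (allFin-+ k l) ⟩
  L.map suc (L.map (_↑ˡ l) (allFin k) L.++ L.map (k ↑ʳ_) (allFin l))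
    ≡⟨ LP.map-++ suc (L.map (_↑ˡ l) (allFin k)) _ ⟩
  L.map suc (L.map (_↑ˡ l) (allFin k)) L.++ L.map suc (L.map (k ↑ʳ_) (allFin l))
    ≡⟨ cong₂ L._++_ (LP.map-∘ (allFin k)) (LP.map-∘ (allFin l)) ⟨
  L.map (λ i → suc (i ↑ˡ l)) (allFin k) L.++ L.map (suc k ↑ʳ_) (allFin l)
    ≡⟨ cong (L._++ L.map (suc k ↑ʳ_) (allFin l)) (LP.map-∘ (allFin k)) ⟩
  L.map (_↑ˡ l) (L.map suc (allFin k)) L.++ L.map (suc k ↑ʳ_) (allFin l)
    ≡⟨ cong (λ z → L.map (_↑ˡ l) z L.++ L.map (suc k ↑ʳ_) (allFin l)) (LP.map-tabulate id suc) ⟩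
  L.map (_↑ˡ l) (L.tabulate suc) L.++ L.map (suc k ↑ʳ_) (allFin l)
    ∎)
  where open ≡-Reasoning

module _ {A : Set} where

  filterᵇ-cong : {p q : A → Bool} → (∀ x → p x ≡ q x) → ∀ xs → filterᵇ p xs ≡ filterᵇ q xs
  filterᵇ-cong {p} {q} eq = LP.filter-≐ (T? ∘ p) (T? ∘ q) ((λ {x} → subst T (eq x)) , (λ {x} → subst T (sym (eq x))))

  filterᵇ-map : {B : Set} (p : B → Bool) (f : A → B) → ∀ xs → filterᵇ p (L.map f xs) ≡ L.map f (filterᵇ (p ∘ f) xs)
  filterᵇ-map p f []       = refl
  filterᵇ-map p f (x ∷ xs) with p (f x)
  ... | true  = cong (f x ∷_) (filterᵇ-map p f xs)
  ... | false = filterᵇ-map p f xs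

filterᵇ-allFin-+ : ∀ k l (p : Fin (k + l) → Bool) → filterᵇ p (allFin (k + l)) ≡
  L.map (_↑ˡ l) (filterᵇ (p ∘ (_↑ˡ l)) (allFin k)) L.++ L.map (k ↑ʳ_) (filterᵇ (p ∘ (k ↑ʳ_)) (allFin l))
filterᵇ-allFin-+ k l p = begin
  filterᵇ p (allFin (k + l))
    ≡⟨ cong (filterᵇ p) (allFin-+ k l) ⟩
  filterᵇ p (L.map (_↑ˡ l) (allFin k) L.++ L.map (k ↑ʳ_) (allFin l))
    ≡⟨ LP.filter-++ (T? ∘ p) (L.map (_↑ˡ l) (allFin k)) _ ⟩
  filterᵇ p (L.map (_↑ˡ l) (allFin k)) L.++ filterᵇ p (L.map (k ↑ʳ_) (allFin l))
    ≡⟨ cong₂ L._++_ (filterᵇ-map p (_↑ˡ l) (allFin k)) (filterᵇ-map p (k ↑ʳ_) (allFin l)) ⟩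
  _ ∎
  where open ≡-Reasoning

countF-+ : ∀ k l (p : Fin (k + l) → Bool) → countF p ≡ countF (p ∘ (_↑ˡ l)) + countF (p ∘ (k ↑ʳ_))
countF-+ k l p = trans (cong length (filterᵇ-allFin-+ k l p))
  (trans (LP.length-++ (L.map (_↑ˡ l) (filterᵇ (p ∘ (_↑ˡ l)) (allFin k))))
    (cong₂ _+_ (LP.length-map (_↑ˡ l) (filterᵇ (p ∘ (_↑ˡ l)) (allFin k)))
               (LP.length-map (k ↑ʳ_) (filterᵇ (p ∘ (k ↑ʳ_)) (allFin l)))))

countF-cong : ∀ {n} {p q : Fin n → Bool} → (∀ i → p i ≡ q i) → countF p ≡ countF q
countF-cong eq = cong length (filterᵇ-cong eq (allFin _))

countF≤n : ∀ {n} (p : Fin n → Bool) → countF p ≤ n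
countF≤n {n} p = subst (countF p ≤_) (LP.length-tabulate {n = n} id) (LP.length-filter (T? ∘ p) (allFin n))

numCycles-⊕ : ∀ {k l} (α : Perm k) (β : Perm l) → numCycles (α ⊕ β) ≡ numCycles α + numCycles β
numCycles-⊕ {k} {l} α β = trans (countF-+ k l (isCycleMin (α ⊕ β)))
  (cong₂ _+_ (countF-cong (Embed.isCycleMin-e (embedˡ α β))) (countF-cong (Embed.isCycleMin-e (embedʳ α β))))

-- The truncated subtraction splits because each cycle count is at most the size of its own summand.
‖‖-⊕ : ∀ {k l} (α : Perm k) (β : Perm l) → ‖ α ⊕ β ‖ ≡ ‖ α ‖ + ‖ β ‖
‖‖-⊕ {k} {l} α β = begin
  (k + l) ∸ numCycles (α ⊕ β)   ≡⟨ cong ((k + l) ∸_) (numCycles-⊕ α β) ⟩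
  (k + l) ∸ (a + b)             ≡⟨ ℕP.∸-+-assoc (k + l) a b ⟨
  ((k + l) ∸ a) ∸ b             ≡⟨ cong (_∸ b) (ℕP.+-∸-comm l (countF≤n (isCycleMin α))) ⟩
  ((k ∸ a) + l) ∸ b             ≡⟨ ℕP.+-∸-assoc (k ∸ a) (countF≤n (isCycleMin β)) ⟩
  (k ∸ a) + (l ∸ b)             ∎
  where
  open ≡-Reasoning
  a = numCycles α
  b = numCycles β

module _ {n} (α : Perm n) (α-inj : Inj α) where

  -- Surjectivity supplies a preimage, so `leastF` in `inv` finds one and never falls back on its
  -- default `j`.
  inv-right : ∀ j → α ! (inv α ! j) ≡ j
  inv-right j = trans (cong (α !_) (VP.lookup∘tabulate _ j))
    (eqF-elim (proj₁ (leastF-spec (λ i → eqF (α ! i) j) j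
      (proj₁ (surjective α α-inj j) , eqF-intro (proj₂ (surjective α α-inj j))))))

  inv-Inj : Inj (inv α)
  inv-Inj eq = trans (sym (inv-right _)) (trans (cong (α !_) eq) (inv-right _))

!-∘ₚ : ∀ {n} (α β : Perm n) i → (α ∘ₚ β) ! i ≡ α ! (β ! i)
!-∘ₚ α β i = VP.lookup∘tabulate _ i

∘ₚ-Inj : ∀ {n} {α β : Perm n} → Inj α → Inj β → Inj (α ∘ₚ β)
∘ₚ-Inj {α = α} {β} a b eq = b (a (trans (sym (!-∘ₚ α β _)) (trans eq (!-∘ₚ α β _))))

module _ {k l} (α : Perm k) (β : Perm l) where

  ⊕-∘ₚ : ∀ (α′ : Perm k) (β′ : Perm l) → (α ⊕ β) ∘ₚ (α′ ⊕ β′) ≡ (α ∘ₚ α′) ⊕ (β ∘ₚ β′)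
  ⊕-∘ₚ α′ β′ = perm-ext λ x → trans (!-∘ₚ (α ⊕ β) (α′ ⊕ β′) x) (go x)
    where
    go : ∀ x → (α ⊕ β) ! ((α′ ⊕ β′) ! x) ≡ ((α ∘ₚ α′) ⊕ (β ∘ₚ β′)) ! x
    go x with side k {l} x
    ... | left i  rewrite ⊕-ˡ α′ β′ i | ⊕-ˡ α β (α′ ! i) | ⊕-ˡ (α ∘ₚ α′) (β ∘ₚ β′) i | !-∘ₚ α α′ i = refl
    ... | right i rewrite ⊕-ʳ α′ β′ i | ⊕-ʳ α β (β′ ! i) | ⊕-ʳ (α ∘ₚ α′) (β ∘ₚ β′) i | !-∘ₚ β β′ i = refl

  inv-⊕ : Inj α → Inj β → inv (α ⊕ β) ≡ inv α ⊕ inv β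
  -- Both sides are compared after applying the injective `α ⊕ β`, where `inv-right` determines
  -- them.
  inv-⊕ α-inj β-inj = perm-ext λ x → αβ-inj (trans (inv-right (α ⊕ β) αβ-inj x) (sym (go x)))
    where
    αβ-inj : Inj (α ⊕ β)
    αβ-inj = ⊕-Inj α β α-inj β-inj
    go : ∀ x → (α ⊕ β) ! ((inv α ⊕ inv β) ! x) ≡ x
    go x with side k {l} x
    ... | left i  rewrite ⊕-ˡ (inv α) (inv β) i | ⊕-ˡ α β (inv α ! i) | inv-right α α-inj i = refl
    ... | right i rewrite ⊕-ʳ (inv α) (inv β) i | ⊕-ʳ α β (inv β ! i) | inv-right β β-inj i = refl

isCycleMin-intro : ∀ {n} (α : Perm n) {i} → (∀ j → Reach α i j → toℕ i ≤ toℕ j) → T (isCycleMin α i)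
isCycleMin-intro α {i} h = allF-intro λ j → ⇒ᵇ-intro {a = sameCycle α i j} λ s → leF-intro (h j (sameCycle-elim α s))

isCycleMin-elim : ∀ {n} (α : Perm n) {i j} → T (isCycleMin α i) → Reach α i j → toℕ i ≤ toℕ j
isCycleMin-elim α {i} {j} t r = leF-elim
  (⇒ᵇ-elim (allF-elim {p = λ j → sameCycle α i j ⇒ᵇ leF i j} t j) (sameCycle-intro α r))

cycleMin : ∀ {n} → Perm n → Fin n → Fin n
cycleMin α i = leastF (sameCycle α i) i

cycleMin-spec : ∀ {n} (α : Perm n) i → Reach α i (cycleMin α i) × T (isCycleMin α (cycleMin α i))
cycleMin-spec α i = r , isCycleMin-intro α λ j s → proj₂ spec j (sameCycle-intro α (Reach-trans α r s))
  where
  spec = leastF-spec (sameCycle α i) i (i , sameCycle-intro α (Reach-refl α))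
  r = sameCycle-elim α (proj₁ spec)

isCycleMin-unique : ∀ {n} (α : Perm n) {i j} → Reach α i j → Reach α j i →
                    T (isCycleMin α i) → T (isCycleMin α j) → i ≡ j
isCycleMin-unique α ij ji mi mj = FP.toℕ-injective (ℕP.≤-antisym
  (isCycleMin-elim α mi ij) (isCycleMin-elim α mj ji))

Unique-lookup-injective : ∀ {A : Set} {xs : List A} → Unique xs → ∀ {i j} → L.lookup xs i ≡ L.lookup xs j → i ≡ j
Unique-lookup-injective (x∉ ∷ u) {zero}  {zero}  eq = refl
Unique-lookup-injective (x∉ ∷ u) {zero}  {suc j} eq = contradiction eq (All.lookup x∉ (∈-lookup j))
Unique-lookup-injective (x∉ ∷ u) {suc i} {zero}  eq = contradiction (sym eq) (All.lookup x∉ (∈-lookup i))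
Unique-lookup-injective (x∉ ∷ u) {suc i} {suc j} eq = cong suc (Unique-lookup-injective u eq)

-- Without repetitions in `xs`, a function injective on entries induces an injection of positions.
length-≤ : ∀ {A B : Set} {xs : List A} {ys : List B} → Unique xs → (f : A → B) →
           (∀ {x y} → x ∈ xs → y ∈ xs → f x ≡ f y → x ≡ y) → (∀ {x} → x ∈ xs → f x ∈ ys) →
           length xs ≤ length ys
length-≤ {xs = xs} {ys} u f f-inj f∈ = FP.injective⇒≤ {f = g} g-inj
  where
  g : Fin (length xs) → Fin (length ys)
  g i = Any.index (f∈ (∈-lookup {xs = xs} i))
  g-inj : ∀ {i j} → g i ≡ g j → i ≡ j
  g-inj {i} {j} eq = Unique-lookup-injective u (f-inj (∈-lookup i) (∈-lookup j)
    (trans (AnyP.lookup-index (f∈ (∈-lookup {xs = xs} i)))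
      (trans (cong (L.lookup ys) eq) (sym (AnyP.lookup-index (f∈ (∈-lookup {xs = xs} j)))))))

-- The hypothesis on `c` says that different cycles of `x` go into different cycles of `y`. Cycles
-- are counted by their minima, which `c` may move, so each image is replaced by the minimum of its
-- cycle.
numCycles-≤ : ∀ {m n} {x : Perm m} {y : Perm n} → Inj x → Inj y → (c : Fin m → Fin n) →
              (∀ {i j} → Reach y (c i) (c j) → Reach x i j) → numCycles x ≤ numCycles y
numCycles-≤ {m} {n} {x} {y} x-inj y-inj c refl⁻ =
  length-≤ (UniqueP.filter⁺ (T? ∘ isCycleMin x) (UniqueP.allFin⁺ m)) (cycleMin y ∘ c) inj
    (λ {i} _ → ∈-filterᵇ⁺ (isCycleMin y) (∈-allFin _) (proj₂ (cycleMin-spec y (c i))))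
  where
  mins = filterᵇ (isCycleMin x) (allFin m)
  inj : ∀ {i j} → i ∈ mins → j ∈ mins → cycleMin y (c i) ≡ cycleMin y (c j) → i ≡ j
  inj {i} {j} i∈ j∈ eq = isCycleMin-unique x r (Reach-sym x x-inj r)
      (proj₂ (∈-filterᵇ⁻ (isCycleMin x) {xs = allFin m} i∈)) (proj₂ (∈-filterᵇ⁻ (isCycleMin x) {xs = allFin m} j∈))
    where
    r : Reach x i j
    r = refl⁻ (Reach-trans y (proj₁ (cycleMin-spec y (c i)))
          (subst (λ z → Reach y z (c j)) (sym eq) (Reach-sym y y-inj (proj₁ (cycleMin-spec y (c j))))))

-- The hypothesis says that c conjugates x⁻¹ to y.
‖‖-conj-inv : ∀ {n} {x y c : Perm n} → Inj x → Inj y → Inj c →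
              (∀ i → y ! (c ! (x ! i)) ≡ c ! i) → ‖ x ‖ ≡ ‖ y ‖
‖‖-conj-inv {n} {x} {y} {c} x-inj y-inj c-inj conj = cong (n ∸_) (ℕP.≤-antisym
    (numCycles-≤ x-inj y-inj (c !_) back)
    (numCycles-≤ y-inj x-inj (inv c !_) λ r → subst₂ (Reach y) (inv-right c c-inj _) (inv-right c c-inj _) (forth r)))
  where
  forth : ∀ {i j} → Reach x i j → Reach y (c ! i) (c ! j)
  forth {i} r = Reach-ind x (λ j → Reach y (c ! i) (c ! j))
    (λ j s → Reach-trans y s (Reach-sym y y-inj (1 , conj j))) r (Reach-refl y)
  back : ∀ {i j} → Reach y (c ! i) (c ! j) → Reach x i j
  -- The induction runs along the orbit of `y`, with every preimage under `c` of the current point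
  -- in the invariant. If `y ! b` is `c ! j`, then `conj` and injectivity of `y` give
  -- `b ≡ c ! (x ! j)`.
  back {i} {j} r = Reach-ind y (λ b → ∀ j → b ≡ c ! j → Reach x i j) step r
      (λ j eq → subst (Reach x i) (c-inj eq) (Reach-refl x)) j refl
    where
    step : ∀ b → (∀ j → b ≡ c ! j → Reach x i j) → ∀ j → y ! b ≡ c ! j → Reach x i j
    step b h j eq = Reach-trans x (h (x ! j) (y-inj (trans eq (sym (conj j))))) (Reach-step⁻ x x-inj j)

-- Full cycles and Kreweras complements

next-last : ∀ {n} (i : Fin (suc n)) → toℕ i ≡ n → next i ≡ zero
next-last {n} i eq with toℕ i ℕ.≟ n
... | yes _ = refl
... | no ne = contradiction eq ne

next-step : ∀ {n} (i : Fin (suc n)) → toℕ i ≢ n → toℕ (next i) ≡ suc (toℕ i)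
next-step {n} i ne with toℕ i ℕ.≟ n
... | yes eq = contradiction eq ne
... | no p   = FP.toℕ-lower₁ (suc i) (λ eq → p (sym (ℕP.suc-injective eq)))

module _ {n : ℕ} where

  γ-last : ∀ {i : Fin (suc n)} → toℕ i ≡ n → γ (suc n) ! i ≡ zero
  γ-last {i} eq = trans (VP.lookup∘tabulate next i) (next-last i eq)

  γ-step : ∀ {i : Fin (suc n)} → toℕ i ≢ n → toℕ (γ (suc n) ! i) ≡ suc (toℕ i)
  γ-step {i} ne = trans (cong toℕ (VP.lookup∘tabulate next i)) (next-step i ne)

  γ-Inj : Inj (γ (suc n))
  γ-Inj {i} {j} eq with toℕ i ℕ.≟ n | toℕ j ℕ.≟ n
  ... | yes p | yes q = FP.toℕ-injective (trans p (sym q))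
  ... | no  p | no  q = FP.toℕ-injective (ℕP.suc-injective (trans (sym (γ-step p)) (trans (cong toℕ eq) (γ-step q))))
  ... | yes p | no  q = contradiction (trans (sym (γ-step q)) (trans (cong toℕ (sym eq)) (cong toℕ (γ-last p)))) λ ()
  ... | no  p | yes q = contradiction (trans (sym (γ-step p)) (trans (cong toℕ eq) (cong toℕ (γ-last q)))) λ ()

  -- Agreement with `γ` is assumed off the last point only, since `Irr-Int⇒γ` uses this reachability
  -- to find the value at the last point.
  steps-reach : ∀ {α : Perm (suc n)} → (∀ i → toℕ i ≢ n → α ! i ≡ γ (suc n) ! i) →
                ∀ k (i : Fin (suc n)) → toℕ i ≡ k → Reach α zero i
  steps-reach {α} h zero    i eq = 0 , FP.toℕ-injective (sym eq)
  steps-reach {α} h (suc k) i eq = subst (Reach α zero) αj≡i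
      (Reach-trans α (steps-reach {α} h k j j≡k) (Reach-step α j))
    where
    k<n : k < n
    k<n = ℕ.s≤s⁻¹ (subst (_< suc n) eq (FP.toℕ<n i))
    j : Fin (suc n)
    j = fromℕ< (ℕP.m<n⇒m<1+n k<n)
    j≡k : toℕ j ≡ k
    j≡k = FP.toℕ-fromℕ< _
    j≢n : toℕ j ≢ n
    j≢n e = ℕP.<⇒≢ k<n (trans (sym j≡k) e)
    αj≡i : α ! j ≡ i
    αj≡i = FP.toℕ-injective (trans (cong toℕ (h j j≢n)) (trans (γ-step j≢n) (trans (cong suc j≡k) (sym eq))))

  γ-reach : ∀ i j → Reach (γ (suc n)) i j
  γ-reach i j = Reach-trans (γ (suc n))
    (Reach-sym (γ (suc n)) γ-Inj (steps-reach (λ _ _ → refl) _ i refl))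
    (steps-reach (λ _ _ → refl) _ j refl)

  γ-NC : IsNCPerm (γ (suc n))
  γ-NC = record { injective = γ-Inj ; increasing = incr ; noncrossing = λ {a} {b} _ _ _ _ _ → γ-reach a b }
    where
    incr : ∀ i → IncreasingTo (γ (suc n)) i (γ (suc n) ! i)
    incr i with toℕ i ℕ.≟ n
    ... | yes p = inj₂ ( (λ j _ → subst (toℕ j ≤_) (sym p) (ℕ.s≤s⁻¹ (FP.toℕ<n j)))
                       , (λ j _ → subst (λ z → toℕ z ≤ toℕ j) (sym (γ-last p)) z≤n))
    ... | no  p = inj₁ ( subst (toℕ i <_) (sym (γ-step p)) ℕP.≤-refl
                       , (λ j _ i<j → subst (_≤ toℕ j) (sym (γ-step p)) i<j))

  γ-InL : ∀ c → InL c (γ (suc n))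
  γ-InL L-NC  = γ-NC
  γ-InL L-Int = γ-NC , λ {i} {k} _ _ _ → γ-reach i k

Irr : ∀ {n} → Perm n → Set
Irr {n} α = ∀ j → suc j < n → ¬ Cut α (suc j)

-- A break between i and its successor inside an interval partition would be a cut.
Irr-Int⇒γ : ∀ {n} {α : Perm (suc n)} → InL L-Int α → Irr α → α ≡ γ (suc n)
Irr-Int⇒γ {n} {α} (nc , cv) irr = perm-ext same
  where
  open IsNCPerm nc
  R-sym : ∀ {i j} → Reach α i j → Reach α j i
  R-sym = Reach-sym α injective

  succ-reach : ∀ {i s : Fin (suc n)} → toℕ s ≡ suc (toℕ i) → Reach α i s
  succ-reach {i} {s} s≡ with Reach? α i s
  ... | yes r = r
  ... | no ¬r = ⊥-elim (irr (toℕ i) (subst (_< suc n) s≡ (FP.toℕ<n s)) cut)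
    where
    -- By convexity, a block that meets both sides of the gap contains both `i` and `s`.
    no-cross : ∀ {x y} → toℕ x ≤ toℕ i → toℕ s ≤ toℕ y → ¬ Reach α x y
    no-cross {x} {y} x≤i s≤y xy = ¬r (Reach-trans α (R-sym xi) xs)
      where
      i<y : toℕ i < toℕ y
      i<y = subst (_≤ toℕ y) s≡ s≤y
      x<s : toℕ x < toℕ s
      x<s = subst (toℕ x <_) (sym s≡) (s≤s x≤i)
      xi : Reach α x i
      xi with ℕP.m≤n⇒m<n∨m≡n x≤i
      ... | inj₁ x<i = cv x<i i<y xy
      ... | inj₂ eq  = subst (Reach α x) (FP.toℕ-injective eq) (Reach-refl α)
      xs : Reach α x s
      xs with ℕP.m≤n⇒m<n∨m≡n s≤y
      ... | inj₁ s<y = cv x<s s<y xy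
      ... | inj₂ eq  = subst (Reach α x) (FP.toℕ-injective (sym eq)) xy
    cut : Cut α (suc (toℕ i))
    cut x = (λ x≤i → ℕP.≰⇒> λ i<αx → no-cross (ℕ.s≤s⁻¹ x≤i) (subst (_≤ _) (sym s≡) i<αx) (Reach-step α x))
          , (λ αx≤i → ℕP.≰⇒> λ i<x → no-cross (ℕ.s≤s⁻¹ αx≤i) (subst (_≤ _) (sym s≡) i<x) (Reach-step⁻ α injective x))

  step : ∀ i → toℕ i ≢ n → α ! i ≡ γ (suc n) ! i
  step i i≢n with increasing i
  ... | inj₁ (i<αi , least) = FP.toℕ-injective (ℕP.≤-antisym
          (least s (succ-reach s≡) (subst (toℕ i <_) (sym s≡) ℕP.≤-refl))
          (subst (_≤ toℕ (α ! i)) (sym s≡) i<αi))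
    where
    s = γ (suc n) ! i
    s≡ = γ-step i≢n
  ... | inj₂ (top , _) = contradiction (top s (succ-reach s≡)) (ℕP.<⇒≱ (subst (toℕ i <_) (sym s≡) ℕP.≤-refl))
    where
    s = γ (suc n) ! i
    s≡ = γ-step i≢n

  same : ∀ i → α ! i ≡ γ (suc n) ! i
  same i with toℕ i ℕ.≟ n
  ... | no  p = step i p
  ... | yes p = trans (FP.toℕ-injective (ℕP.n≤0⇒n≡0 (α!i≤0 (increasing i)))) (sym (γ-last p))
    where
    -- The steps already known put `zero` into the block of the last point, and an increasing cycle
    -- returns from its maximum to its minimum.
    i→0 : Reach α i zero
    i→0 = R-sym (steps-reach step _ i refl)
    α!i≤0 : IncreasingTo α i (α ! i) → toℕ (α ! i) ≤ 0
    α!i≤0 (inj₁ (i<αi , _)) = contradiction (ℕ.s≤s⁻¹ (FP.toℕ<n (α ! i))) (ℕP.<⇒≱ (subst (_< toℕ (α ! i)) p i<αi))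
    α!i≤0 (inj₂ (_ , least)) = least zero i→0

module _ {n} {α : Perm (suc n)} (nc : IsNCPerm α) where
  open IsNCPerm nc
  private
    κα = Kr α
    R-sym : ∀ {i j} → Reach α i j → Reach α j i
    R-sym = Reach-sym α injective

  Kr-Inj : Inj (Kr α)
  Kr-Inj = ∘ₚ-Inj {α = inv α} {γ (suc n)} (inv-Inj α injective) γ-Inj

  -- This equation and `Kr-unique` replace the formula for `Kr` wherever its orbits are traced.
  α-Kr : ∀ i → α ! (Kr α ! i) ≡ γ (suc n) ! i
  α-Kr i = trans (cong (α !_) (!-∘ₚ (inv α) (γ (suc n)) i)) (inv-right α injective _)

  Kr-unique : ∀ {i j} → α ! j ≡ γ (suc n) ! i → Kr α ! i ≡ j
  Kr-unique {i} eq = injective (trans (α-Kr i) (sym eq))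

  -- If α jumps from a over b = α a, the elements strictly between a and b form unions of
  -- blocks, so the Kreweras complement preserves the interval [a, b).
  Kr-interval : ∀ a → toℕ a < toℕ (α ! a) → ∀ x → toℕ a ≤ toℕ x × toℕ x < toℕ (α ! a) →
                toℕ a ≤ toℕ (Kr α ! x) × toℕ (Kr α ! x) < toℕ (α ! a)
  Kr-interval a a<b x (a≤x , x<b) = goal (ℕP.m≤n⇒m<n∨m≡n (subst (_≤ toℕ b) (sym sx≡) x<b))
    where
    b = α ! a
    s = γ (suc n) ! x
    y = Kr α ! x
    x≢n : toℕ x ≢ n
    x≢n eq = ℕP.<⇒≱ (subst (_< toℕ b) eq x<b) (ℕ.s≤s⁻¹ (FP.toℕ<n b))
    sx≡ : toℕ s ≡ suc (toℕ x)
    sx≡ = γ-step x≢n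
    ys : Reach α y s
    ys = 1 , α-Kr x
    least : ∀ j → Reach α a j → toℕ a < toℕ j → toℕ b ≤ toℕ j
    least with increasing a
    ... | inj₁ (_ , l)   = l
    ... | inj₂ (top , _) = contradiction (top b (Reach-step α a)) (ℕP.<⇒≱ a<b)
    a<s : toℕ a < toℕ s
    a<s = subst (toℕ a <_) (sym sx≡) (s≤s a≤x)
    goal : toℕ s < toℕ b ⊎ toℕ s ≡ toℕ b → toℕ a ≤ toℕ y × toℕ y < toℕ b
    -- Here `γ` sends `x` to `b = α a`, so the complement sends `x` to `a` itself.
    goal (inj₂ s≡b) = subst (λ z → toℕ a ≤ toℕ z × toℕ z < toℕ b)
      (sym (Kr-unique {x} {a} (FP.toℕ-injective (sym s≡b)))) (ℕP.≤-refl , a<b)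
    goal (inj₁ s<b) = ℕP.≮⇒≥ y≮a , ℕP.≰⇒> b≰y
      where
      -- No element of the block of `a` lies strictly between `a` and `b`. As `y` shares a block
      -- with `s`, placing `y` outside the interval either makes that block cross the one of `a` and
      -- `b` or, for `y = b`, merges the two.
      a≁s : ¬ Reach α a s
      a≁s r = ℕP.<⇒≱ s<b (least s r a<s)
      y≮a : ¬ toℕ y < toℕ a
      y≮a y<a = a≁s (Reach-trans α (R-sym (noncrossing y<a a<s s<b ys (Reach-step α a))) ys)
      b≰y : ¬ toℕ b ≤ toℕ y
      b≰y b≤y with ℕP.m≤n⇒m<n∨m≡n b≤y
      ... | inj₁ b<y = a≁s (noncrossing a<s s<b b<y (Reach-step α a) (R-sym ys))
      ... | inj₂ b≡y = a≁s (Reach-trans α (Reach-step α a) (subst (λ z → Reach α z s) (FP.toℕ-injective (sym b≡y)) ys))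

  -- If `α` carried some `i ≤ k` beyond `k`, the interval from `i` up to but excluding `α i` would
  -- contain `k` and be invariant under `Kr α`. It would then contain `last`, and `α i` would exceed
  -- the largest index.
  Kr-reach⇒Cut : ∀ {k last} → toℕ last ≡ n → Reach (Kr α) k last → Cut α (suc (toℕ k))
  Kr-reach⇒Cut {k} {last} last≡n r i = (λ le → s≤s (down i (ℕ.s≤s⁻¹ le))) , up
    where
    down : ∀ i → toℕ i ≤ toℕ k → toℕ (α ! i) ≤ toℕ k
    down i i≤k = ℕP.≮⇒≥ λ k<αi →
      let _ , last<αi = Reach-ind (Kr α) (λ z → toℕ i ≤ toℕ z × toℕ z < toℕ (α ! i))
                          (Kr-interval i (ℕP.≤-<-trans i≤k k<αi)) r (i≤k , k<αi)
      in ℕP.<⇒≱ (subst (_< toℕ (α ! i)) last≡n last<αi) (ℕ.s≤s⁻¹ (FP.toℕ<n (α ! i)))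
    up : toℕ (α ! i) < suc (toℕ k) → toℕ i < suc (toℕ k)
    -- On a finite cycle `i` is a forward iterate of `α i`, so iterating `down` gives the converse.
    up le = s≤s (Reach-ind α (λ z → toℕ z ≤ toℕ k) down (Reach-step⁻ α injective i) (ℕ.s≤s⁻¹ le))

  -- After a cut, s is the least element of its block and e = α⁻¹ s the greatest; no other
  -- block can leave [s, e] without crossing this one.
  Cut-block-end : ∀ {s e} → α ! e ≡ s → Cut α (toℕ s) → toℕ s ≤ toℕ e × Cut α (suc (toℕ e))
  Cut-block-end {s} {e} αe≡s cut = s≤e , λ i → (λ lt → s≤s (down i (ℕ.s≤s⁻¹ lt))) , (λ lt → s≤s (up i (ℕ.s≤s⁻¹ lt)))
    where
    se : Reach α s e
    se = R-sym (1 , αe≡s)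
    s≤e : toℕ s ≤ toℕ e
    s≤e = Cut-reach⁻ {α = α} cut se ℕP.≤-refl
    top : ∀ j → Reach α e j → toℕ j ≤ toℕ e
    top with increasing e
    ... | inj₁ (e<αe , _) = contradiction s≤e (ℕP.<⇒≱ (subst (λ z → toℕ e < toℕ z) αe≡s e<αe))
    ... | inj₂ (t , _)    = t
    no-cross : ∀ {x y} → toℕ x ≤ toℕ e → toℕ e < toℕ y → toℕ s ≤ toℕ x → ¬ Reach α x y
    no-cross {x} {y} x≤e e<y s≤x xy with ℕP.m≤n⇒m<n∨m≡n x≤e | ℕP.m≤n⇒m<n∨m≡n s≤x
    ... | inj₂ x≡e | _ = ℕP.<⇒≱ e<y (top y (subst (λ z → Reach α z y) (FP.toℕ-injective x≡e) xy))
    ... | inj₁ _   | inj₂ s≡x = ℕP.<⇒≱ e<y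
            (top y (Reach-trans α (R-sym se) (subst (λ z → Reach α z y) (FP.toℕ-injective (sym s≡x)) xy)))
    ... | inj₁ x<e | inj₁ s<x = ℕP.<⇒≱ e<y
            (top y (Reach-trans α (R-sym se) (Reach-trans α (noncrossing s<x x<e e<y se xy) xy)))
    down : ∀ i → toℕ i ≤ toℕ e → toℕ (α ! i) ≤ toℕ e
    down i i≤e with toℕ i ℕ.<? toℕ s
    ... | yes i<s = ℕP.≤-trans (ℕP.<⇒≤ (proj₁ (cut i) i<s)) s≤e
    ... | no  i≮s = ℕP.≮⇒≥ λ e<αi → no-cross i≤e e<αi (ℕP.≮⇒≥ i≮s) (Reach-step α i)
    up : ∀ i → toℕ (α ! i) ≤ toℕ e → toℕ i ≤ toℕ e
    up i = Reach-ind α (λ z → toℕ z ≤ toℕ e) down (Reach-step⁻ α injective i)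

  -- From `last`, `γ` wraps to `zero`, and the complement lands on the end of the block starting
  -- there. Every further step lands on the end of the block starting just after the previous end.
  -- The cut after `k` keeps each of these blocks from jumping over `k`, so the increasing ends hit
  -- it.
  Cut⇒Kr-reach : ∀ {k last} → toℕ last ≡ n → toℕ k < n → Cut α (suc (toℕ k)) → Reach (Kr α) last k
  Cut⇒Kr-reach {k} {last} last≡n k<n cutₖ = go (toℕ k) last zero (γ-last last≡n) z≤n (λ i → (λ ()) , λ ()) ℕP.≤-refl
    where
    -- `s` is the start of the next block and `y` its predecessor under `γ`. The fuel bounds the
    -- distance from `s` to `k`; each block advances `s` by at least one.
    go : ∀ fuel y s → γ (suc n) ! y ≡ s → toℕ s ≤ toℕ k → Cut α (toℕ s) → toℕ k ≤ toℕ s + fuel →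
         Reach (Kr α) y k
    go fuel y s γy≡s s≤k cutₛ bound = Reach-trans (Kr α) (Reach-step (Kr α) y) (finish (ℕP.m≤n⇒m<n∨m≡n e≤k) fuel bound)
      where
      e = Kr α ! y
      αe≡s : α ! e ≡ s
      αe≡s = trans (α-Kr y) γy≡s
      block = Cut-block-end αe≡s cutₛ
      e≤k : toℕ e ≤ toℕ k
      e≤k = ℕ.s≤s⁻¹ (Cut-reach⁺ {α = α} cutₖ (R-sym (1 , αe≡s)) (s≤s s≤k))
      finish : toℕ e < toℕ k ⊎ toℕ e ≡ toℕ k → ∀ fuel → toℕ k ≤ toℕ s + fuel → Reach (Kr α) e k
      finish (inj₂ e≡k) _ _ = subst (Reach (Kr α) e) (FP.toℕ-injective e≡k) (Reach-refl (Kr α))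
      finish (inj₁ e<k) zero b = contradiction
        (ℕP.≤-trans b (subst (_≤ toℕ e) (sym (ℕP.+-identityʳ (toℕ s))) (proj₁ block))) (ℕP.<⇒≱ e<k)
      finish (inj₁ e<k) (suc fuel) b = go fuel e s′ refl (subst (_≤ toℕ k) (sym s′≡) e<k)
          (subst (Cut α) (sym s′≡) (proj₂ block))
          (ℕP.≤-trans b (subst₂ _≤_ (sym (ℕP.+-suc (toℕ s) fuel)) (cong (_+ fuel) (sym s′≡))
            (s≤s (ℕP.+-monoˡ-≤ fuel (proj₁ block)))))
        where
        s′ = γ (suc n) ! e
        s′≡ : toℕ s′ ≡ suc (toℕ e)
        s′≡ = γ-step λ eq → ℕP.<⇒≢ (ℕP.<-trans e<k k<n) eq

-- The meet with KrInt

≤ᴾ-intro : ∀ {n} (ρ τ : Perm n) → (∀ {i j} → Reach ρ i j → Reach τ i j) → T (ρ ≤ᴾ τ)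
≤ᴾ-intro ρ τ h = allF-intro λ i → allF-intro λ j →
  ⇒ᵇ-intro {a = sameCycle ρ i j} λ s → sameCycle-intro τ (h (sameCycle-elim ρ s))

≤ᴾ-elim : ∀ {n} (ρ τ : Perm n) → T (ρ ≤ᴾ τ) → ∀ {i j} → Reach ρ i j → Reach τ i j
≤ᴾ-elim {n} ρ τ t {i} {j} r = sameCycle-elim τ (⇒ᵇ-elim
  (allF-elim {p = λ j → sameCycle ρ i j ⇒ᵇ sameCycle τ i j}
    (allF-elim {p = λ i → allF λ j → sameCycle ρ i j ⇒ᵇ sameCycle τ i j} t i) j) (sameCycle-intro ρ r))

idP-reach : ∀ {n} {i j : Fin n} → Reach (idP n) i j → i ≡ j
idP-reach {n} {i} r = Reach-ind (idP n) (i ≡_) (λ x eq → trans eq (sym (VP.lookup∘tabulate id x))) r refl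

≤ᴾ-idP : ∀ {n} (τ : Perm n) → T (idP n ≤ᴾ τ)
≤ᴾ-idP {n} τ = ≤ᴾ-intro (idP n) τ λ {i} r → subst (Reach τ i) (idP-reach r) (Reach-refl τ)

-- The identity lies below everything, so its maximality reduces to membership in `KrInt` and
-- triviality of the common lower bounds.
meet-intro : ∀ {n} (α β : Perm n) → idP n ∈ KrInt n →
             (∀ {ρ} → ρ ∈ KrInt n → T (ρ ≤ᴾ α) → T (ρ ≤ᴾ β) → T (ρ ≤ᴾ idP n)) → T (meetKrIntIsZero α β)
meet-intro {n} α β id∈ below = ∧-intro
    (any-intro (eqPerm (idP n)) (∈-filterᵇ⁺ lower id∈ (∧-intro (≤ᴾ-idP α) (≤ᴾ-idP β)))
      (allF-intro {p = λ i → eqF (idP n ! i) (idP n ! i)} λ i → eqF-intro {i = idP n ! i} refl))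
    (all-intro (_≤ᴾ idP n) (filterᵇ lower (KrInt n)) λ {ρ} ρ∈ →
      let ρ∈Kr , t = ∈-filterᵇ⁻ lower {xs = KrInt n} ρ∈
          ρ≤α , ρ≤β = ∧-elim {ρ ≤ᴾ α} t
      in below ρ∈Kr ρ≤α ρ≤β)
  where
  lower : Perm n → Bool
  lower ρ = (ρ ≤ᴾ α) ∧ (ρ ≤ᴾ β)

meet-elim : ∀ {n} (α β : Perm n) → T (meetKrIntIsZero α β) → ∀ {ρ} → ρ ∈ KrInt n →
            T (ρ ≤ᴾ α) → T (ρ ≤ᴾ β) → T (ρ ≤ᴾ idP n)
meet-elim {n} α β t {ρ} ρ∈ ρ≤α ρ≤β = all-elim (_≤ᴾ idP n) (filterᵇ lower (KrInt n))
    (proj₂ (∧-elim {any (eqPerm (idP n)) (filterᵇ lower (KrInt n))} t))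
    (∈-filterᵇ⁺ lower ρ∈ (∧-intro ρ≤α ρ≤β))
  where
  lower : Perm n → Bool
  lower ρ = (ρ ≤ᴾ α) ∧ (ρ ≤ᴾ β)

Kr-γ : ∀ n → Kr (γ (suc n)) ≡ idP (suc n)
Kr-γ n = perm-ext λ i → trans (Kr-unique γ-NC {i} {i} refl) (sym (VP.lookup∘tabulate id i))

module _ {j l : ℕ} where

  private
    -- With this `n`, `suc n` reduces to `suc j + suc l`, the size of `ρ`. Indices start at zero:
    -- the cut at `suc j` follows the point `k` of value `j`, and `last` has value `n`.
    n = j + suc l
    ρ = γ (suc j) ⊕ γ (suc l)
    k last : Fin (suc n)
    k = fromℕ j ↑ˡ suc l
    last = suc j ↑ʳ fromℕ l

    k≡j : toℕ k ≡ j
    k≡j = trans (FP.toℕ-↑ˡ (fromℕ j) (suc l)) (FP.toℕ-fromℕ j)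

    last≡n : toℕ last ≡ n
    last≡n = trans (FP.toℕ-↑ʳ (suc j) (fromℕ l)) (trans (cong (suc j +_) (FP.toℕ-fromℕ l)) (sym (ℕP.+-suc j l)))

    j<n : j < n
    j<n = ℕP.m<m+n j (s≤s z≤n)

    ρ-Int : InL L-Int ρ
    ρ-Int = ⊕-InL⁺ (γ (suc j)) (γ (suc l)) L-Int (γ-InL L-Int) (γ-InL L-Int)

    cutρ : Cut ρ (suc (toℕ k))
    cutρ = subst (Cut ρ ∘ suc) (sym k≡j) (Cut-⊕⁺ (γ (suc j)) (γ (suc l)) ℕP.≤-refl (Cut-end (γ (suc j))))

    -- `ρ` closes its second block by sending `last` to the point `suc j`, which is also the
    -- successor of `k` under `γ`.
    Kr-ρ-k : ∀ (i : Fin (suc j)) → toℕ i ≡ j → Kr ρ ! (i ↑ˡ suc l) ≡ last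
    Kr-ρ-k i i≡j = Kr-unique (proj₁ ρ-Int) {i ↑ˡ suc l} {last} (FP.toℕ-injective (begin
      toℕ (ρ ! last)                             ≡⟨ cong toℕ (⊕-ʳ (γ (suc j)) (γ (suc l)) (fromℕ l)) ⟩
      toℕ (suc j ↑ʳ (γ (suc l) ! fromℕ l))       ≡⟨ FP.toℕ-↑ʳ (suc j) (γ (suc l) ! fromℕ l) ⟩
      suc j + toℕ (γ (suc l) ! fromℕ l)          ≡⟨ cong (λ z → suc j + toℕ z) (γ-last (FP.toℕ-fromℕ l)) ⟩
      suc j + 0                                  ≡⟨ ℕP.+-identityʳ (suc j) ⟩
      suc j                                      ≡⟨ cong suc i≡ ⟨
      suc (toℕ (i ↑ˡ suc l))                     ≡⟨ γ-step (λ eq → ℕP.<⇒≢ j<n (trans (sym i≡) eq)) ⟨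
      toℕ (γ (suc n) ! (i ↑ˡ suc l))             ∎))
      where
      open ≡-Reasoning
      i≡ : toℕ (i ↑ˡ suc l) ≡ j
      i≡ = trans (FP.toℕ-↑ˡ i (suc l)) i≡j

    -- `ρ` closes its first block by sending `k` to `zero`, where `γ` sends `last`.
    Kr-ρ-last : ∀ (i : Fin (suc l)) → toℕ i ≡ l → Kr ρ ! (suc j ↑ʳ i) ≡ k
    Kr-ρ-last i i≡l = Kr-unique (proj₁ ρ-Int) {suc j ↑ʳ i} {k}
      (trans (⊕-ˡ (γ (suc j)) (γ (suc l)) (fromℕ j))
        (trans (cong (_↑ˡ suc l) (γ-last (FP.toℕ-fromℕ j)))
          (sym (γ-last (trans (FP.toℕ-↑ʳ (suc j) i) (trans (cong (suc j +_) i≡l) (sym (ℕP.+-suc j l))))))))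

    Kr-ρ-ˡ : ∀ (i : Fin (suc j)) → toℕ i ≢ j → Kr ρ ! (i ↑ˡ suc l) ≡ i ↑ˡ suc l
    Kr-ρ-ˡ i i≢j = Kr-unique (proj₁ ρ-Int) {x} {x} (FP.toℕ-injective (begin
      toℕ (ρ ! x)                          ≡⟨ cong toℕ (⊕-ˡ (γ (suc j)) (γ (suc l)) i) ⟩
      toℕ ((γ (suc j) ! i) ↑ˡ suc l)       ≡⟨ FP.toℕ-↑ˡ (γ (suc j) ! i) (suc l) ⟩
      toℕ (γ (suc j) ! i)                  ≡⟨ γ-step i≢j ⟩
      suc (toℕ i)                          ≡⟨ cong suc (FP.toℕ-↑ˡ i (suc l)) ⟨
      suc (toℕ x)                          ≡⟨ γ-step (ℕP.<⇒≢ (ℕP.<-≤-trans (↑ˡ<k (suc l) i) j<n)) ⟨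
      toℕ (γ (suc n) ! x)                  ∎))
      where
      open ≡-Reasoning
      x = i ↑ˡ suc l

    Kr-ρ-ʳ : ∀ (i : Fin (suc l)) → toℕ i ≢ l → Kr ρ ! (suc j ↑ʳ i) ≡ suc j ↑ʳ i
    Kr-ρ-ʳ i i≢l = Kr-unique (proj₁ ρ-Int) {x} {x} (FP.toℕ-injective (begin
      toℕ (ρ ! x)                          ≡⟨ cong toℕ (⊕-ʳ (γ (suc j)) (γ (suc l)) i) ⟩
      toℕ (suc j ↑ʳ (γ (suc l) ! i))       ≡⟨ FP.toℕ-↑ʳ (suc j) (γ (suc l) ! i) ⟩
      suc j + toℕ (γ (suc l) ! i)          ≡⟨ cong (suc j +_) (γ-step i≢l) ⟩
      suc j + suc (toℕ i)                  ≡⟨ ℕP.+-suc (suc j) (toℕ i) ⟩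
      suc (suc j + toℕ i)                  ≡⟨ cong suc (FP.toℕ-↑ʳ (suc j) i) ⟨
      suc (toℕ x)                          ≡⟨ γ-step x≢n ⟨
      toℕ (γ (suc n) ! x)                  ∎))
      where
      open ≡-Reasoning
      x = suc j ↑ʳ i
      x≢n : toℕ x ≢ n
      x≢n eq = i≢l (ℕP.+-cancelˡ-≡ (suc j) (toℕ i) l
        (trans (sym (FP.toℕ-↑ʳ (suc j) i)) (trans eq (ℕP.+-suc j l))))

    -- `Kr ρ` moves only `k` and `last`, so it suffices that these two share a cycle of `Kr α`.
    Kr-ρ≤ : ∀ {α : Perm (suc n)} → IsNCPerm α → Cut α (suc j) → T (Kr ρ ≤ᴾ Kr α)
    Kr-ρ≤ {α} nc cut = ≤ᴾ-intro (Kr ρ) (Kr α) λ {x} r →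
        Reach-ind (Kr ρ) (Reach (Kr α) x) (λ y s → Reach-trans (Kr α) s (step y)) r (Reach-refl (Kr α))
      where
      last→k : Reach (Kr α) last k
      last→k = Cut⇒Kr-reach nc last≡n (subst (_< n) (sym k≡j) j<n) (subst (Cut α ∘ suc) (sym k≡j) cut)
      trivial : ∀ {x y} → y ≡ x → Reach (Kr α) x y
      trivial eq = 0 , sym eq
      step : ∀ x → Reach (Kr α) x (Kr ρ ! x)
      step x with side (suc j) {suc l} x
      step .(i ↑ˡ suc l) | left i with toℕ i ℕ.≟ j
      ... | no  i≢j = trivial (Kr-ρ-ˡ i i≢j)
      ... | yes i≡j = subst₂ (Reach (Kr α))
            (FP.toℕ-injective (trans k≡j (sym (trans (FP.toℕ-↑ˡ i (suc l)) i≡j)))) (sym (Kr-ρ-k i i≡j))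
            (Reach-sym (Kr α) (Kr-Inj nc) last→k)
      step .(suc j ↑ʳ i) | right i with toℕ i ℕ.≟ l
      ... | no  i≢l = trivial (Kr-ρ-ʳ i i≢l)
      ... | yes i≡l = subst₂ (Reach (Kr α))
            (cong (suc j ↑ʳ_) (FP.toℕ-injective (trans (FP.toℕ-fromℕ l) (sym i≡l)))) (sym (Kr-ρ-last i i≡l)) last→k

  -- `Kr ρ` is a common lower bound. It is not the identity: `ρ` has the cut too, so `Kr ρ` joins
  -- `last` to `k`.
  common-cut⇒¬meet : ∀ {α β : Perm (suc (j + suc l))} → IsNCPerm α → IsNCPerm β → Cut α (suc j) → Cut β (suc j) →
                     ¬ T (meetKrIntIsZero (Kr α) (Kr β))
  common-cut⇒¬meet {α} {β} ncα ncβ cutα cutβ t = last≢k (idP-reach (≤ᴾ-elim (Kr ρ) (idP (suc n)) ρ≤id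
      (Cut⇒Kr-reach (proj₁ ρ-Int) last≡n (subst (_< n) (sym k≡j) j<n) cutρ)))
    where
    ρ≤id : T (Kr ρ ≤ᴾ idP (suc n))
    ρ≤id = meet-elim (Kr α) (Kr β) t (∈-map⁺ Kr (Lset-∈⁺ L-Int ρ-Int)) (Kr-ρ≤ ncα cutα) (Kr-ρ≤ ncβ cutβ)
    last≢k : last ≢ k
    last≢k eq = ℕP.<⇒≢ j<n (trans (sym k≡j) (trans (cong toℕ (sym eq)) last≡n))

-- Unfolds to the same type as `Irreducible` of `pair-family`, whose decision procedure thereby
-- decides it.
NoCommonCut : ∀ {n} → Perm n → Perm n → Set
NoCommonCut {n} α β = ∀ j → suc j < n → ¬ (Cut α (suc j) × Cut β (suc j))

module _ {n} {α β : Perm (suc n)} (ncα : IsNCPerm α) (ncβ : IsNCPerm β) where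

  meet⇒noCommonCut : T (meetKrIntIsZero (Kr α) (Kr β)) → NoCommonCut α β
  meet⇒noCommonCut t j j<n (cutα , cutβ) = 
    -- The size must take the form `suc (j + suc l)`; here `l` is `n ∸ suc j`, and `go` makes the
    -- size a variable so that `refl` can be matched.
    go (trans (ℕP.+-suc j (n ∸ suc j)) (ℕP.m+[n∸m]≡n {suc j} {n} (ℕ.s≤s⁻¹ j<n))) ncα ncβ cutα cutβ t
    where
    go : ∀ {n l} {α β : Perm (suc n)} → j + suc l ≡ n → IsNCPerm α → IsNCPerm β →
         Cut α (suc j) → Cut β (suc j) → ¬ T (meetKrIntIsZero (Kr α) (Kr β))
    go {l = l} refl = common-cut⇒¬meet {j} {l}

  -- For a common lower bound `Kr ρ′`, a cut of `ρ′` joins its point to the last one in `Kr ρ′`,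
  -- hence in `Kr α` and `Kr β`, and so cuts both `α` and `β`. Thus `ρ′` has no proper cut; it is
  -- the full cycle, with identity complement.
  noCommonCut⇒meet : NoCommonCut α β → T (meetKrIntIsZero (Kr α) (Kr β))
  noCommonCut⇒meet none = meet-intro (Kr α) (Kr β)
      (subst (_∈ KrInt (suc n)) (Kr-γ n) (∈-map⁺ Kr (Lset-∈⁺ L-Int (γ-InL L-Int)))) below
    where
    below : ∀ {ρ} → ρ ∈ KrInt (suc n) → T (ρ ≤ᴾ Kr α) → T (ρ ≤ᴾ Kr β) → T (ρ ≤ᴾ idP (suc n))
    below ρ∈ ρ≤α ρ≤β with ∈-map⁻ Kr ρ∈
    ... | ρ′ , ρ′∈ , refl = subst (λ z → T (z ≤ᴾ idP (suc n)))
            (sym (trans (cong Kr (Irr-Int⇒γ ρ′-Int irr)) (Kr-γ n))) (≤ᴾ-idP (idP (suc n)))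
      where
      ρ′-Int = Lset-∈⁻ L-Int ρ′∈
      irr : Irr ρ′
      irr j j<n cut = none j j<n (transfer ncα ρ≤α , transfer ncβ ρ≤β)
        where
        k : Fin (suc n)
        k = fromℕ< (ℕP.<-trans (ℕP.n<1+n j) j<n)
        k≡j : toℕ k ≡ j
        k≡j = FP.toℕ-fromℕ< _
        r : Reach (Kr ρ′) (fromℕ n) k
        r = Cut⇒Kr-reach (proj₁ ρ′-Int) (FP.toℕ-fromℕ n) (subst (_< n) (sym k≡j) (ℕ.s≤s⁻¹ j<n))
              (subst (Cut ρ′ ∘ suc) (sym k≡j) cut)
        transfer : ∀ {τ : Perm (suc n)} → IsNCPerm τ → T (Kr ρ′ ≤ᴾ Kr τ) → Cut τ (suc j)
        transfer {τ} nc le = subst (Cut τ ∘ suc) k≡j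
          (Kr-reach⇒Cut nc (FP.toℕ-fromℕ n) (Reach-sym (Kr τ) (Kr-Inj nc) (≤ᴾ-elim (Kr ρ′) (Kr τ) le r)))

-- Decomposition at the first cut

-- The part before the first cut is nonempty, hence `suc k`; the remainder `l` may be zero. Keeping
-- `eq` as a field lets one list hold all splits of a fixed `n`.
record Split (n : ℕ) : Set where
  constructor split
  field
    k l : ℕ
    eq  : suc k + l ≡ n

open Split

sucSplit : ∀ {n} → Split n → Split (suc n)
sucSplit (split k l eq) = split (suc k) l (cong suc eq)

splits : ∀ n → List (Split n)
splits zero    = []
splits (suc n) = split 0 n refl ∷ L.map sucSplit (splits n)

∈-splits : ∀ k l → split k l refl ∈ splits (suc k + l)
∈-splits zero    l = here refl
∈-splits (suc k) l = there (∈-map⁺ sucSplit (∈-splits k l))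

splits-sorted : ∀ n → AllPairs (λ s t → k s < k t) (splits n)
splits-sorted zero    = []
splits-sorted (suc n) =
    AllP.map⁺ (All.universal (λ _ → s≤s z≤n) (splits n))
  ∷ APP.map⁺ (AP.map s≤s (splits-sorted n))

least : {P : ℕ → Set} → (∀ j → Dec (P j)) → ∀ n → P n → ∃ λ j → j ≤ n × P j × (∀ i → i < j → ¬ P i)
least P? zero    p = 0 , z≤n , p , λ _ ()
least P? (suc n) p with P? 0
... | yes p₀ = 0 , z≤n , p₀ , λ _ ()
... | no ¬p₀ with least (P? ∘ suc) n p
... | j , j≤n , pj , below = suc j , s≤s j≤n , pj , λ { zero _ → ¬p₀ ; (suc i) (s≤s i<j) → below i i<j }

-- Graded objects with a direct sum and cuts, the common setting for interval partitions and for
-- pairs of partitions.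
record Family : Set₁ where
  infixr 6 _⊞_
  field
    A         : ℕ → Set
    S         : ∀ n → List (A n)
    S-unique  : ∀ n → Unique (S n)
    _⊞_       : ∀ {k l} → A k → A l → A (k + l)
    ⊞-injective : ∀ {k l} {x x′ : A k} {y y′ : A l} → x ⊞ y ≡ x′ ⊞ y′ → x ≡ x′ × y ≡ y′
    ⊞-∈⁺      : ∀ {k l} {x : A k} {y : A l} → x ∈ S k → y ∈ S l → x ⊞ y ∈ S (k + l)
    ⊞-∈⁻      : ∀ {k l} {x : A k} {y : A l} → x ⊞ y ∈ S (k + l) → x ∈ S k × y ∈ S l
    CutAt     : ∀ {n} → A n → ℕ → Set
    CutAt?    : ∀ {n} (x : A n) j → Dec (CutAt x j)
    CutAt-end : ∀ {n} (x : A n) → CutAt x n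
    CutAt-split : ∀ {k l} (x : A (k + l)) → CutAt x k → ∃ λ (y : A k) → ∃ λ (z : A l) → x ≡ y ⊞ z
    CutAt-⊞⁺  : ∀ {k l j} {x : A k} {y : A l} → j ≤ k → CutAt x j → CutAt (x ⊞ y) j
    CutAt-⊞⁻  : ∀ {k l j} {x : A k} {y : A l} → j ≤ k → CutAt (x ⊞ y) j → CutAt x j

  Irreducible : ∀ {n} → A n → Set
  Irreducible {n} x = ∀ j → suc j < n → ¬ CutAt x (suc j)

  Irreducible? : ∀ {n} (x : A n) → Dec (Irreducible x)
  Irreducible? {n} x = map′ (λ h j j<n → h (ℕP.<-trans (ℕP.n<1+n j) j<n) j<n) (λ h {j} _ → h j)
    (ℕP.allUpTo? (λ j → (suc j ℕ.<? n) →-dec ¬? (CutAt? x (suc j))) n)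

  irreducibles : ∀ n → List (A n)
  irreducibles n = L.filter Irreducible? (S n)

  assemble : ∀ {n} (s : Split n) → A (suc (k s)) × A (l s) → A n
  assemble (split k l refl) (x , y) = x ⊞ y

  components : ∀ {n} (s : Split n) → List (A (suc (k s)) × A (l s))
  components s = L.cartesianProduct (irreducibles (suc (k s))) (S (l s))

  assembled : ∀ {n} → Split n → List (A n)
  assembled s = L.map (assemble s) (components s)

  assemble-injective : ∀ {n} (s : Split n) {p q} → assemble s p ≡ assemble s q → p ≡ q
  assemble-injective (split k l refl) eq = let eq₁ , eq₂ = ⊞-injective eq in cong₂ _,_ eq₁ eq₂

  assemble-cut⁺ : ∀ {n} (s : Split n) p → CutAt (assemble s p) (suc (k s))
  assemble-cut⁺ (split k l refl) (x , y) = CutAt-⊞⁺ ℕP.≤-refl (CutAt-end x)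

  assemble-cut⁻ : ∀ {n} (s : Split n) p {j} → j ≤ suc (k s) → CutAt (assemble s p) j → CutAt (proj₁ p) j
  assemble-cut⁻ (split k l refl) (x , y) = CutAt-⊞⁻

  components-∈⁻ : ∀ {n} (s : Split n) {x y} → (x , y) ∈ components s →
                  x ∈ S (suc (k s)) × Irreducible x × y ∈ S (l s)
  components-∈⁻ s p∈ =
    let x∈ , y∈ = ∈-cartesianProduct⁻ (irreducibles (suc (k s))) (S (l s)) p∈
        x∈S , irr = ∈-filter⁻ Irreducible? {xs = S (suc (k s))} x∈
    in x∈S , irr , y∈

  first-cut : ∀ {n} {x : A (suc n)} → x ∈ S (suc n) → x ∈ L.concatMap assembled (splits (suc n))
  first-cut {n} {x} x∈ = go x x∈ (least (λ j → CutAt? x (suc j)) n (CutAt-end x))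
    where
    go : ∀ {n} (x : A (suc n)) → x ∈ S (suc n) →
         (∃ λ j → j ≤ n × CutAt x (suc j) × (∀ i → i < j → ¬ CutAt x (suc i))) →
         x ∈ L.concatMap assembled (splits (suc n))
    go x x∈ (j , j≤n , cut , first) with ℕP.m≤n⇒∃[o]m+o≡n j≤n
    ... | l , refl with CutAt-split {suc j} {l} x cut
    ... | y , z , refl =
      ∈-concat⁺′ (∈-map⁺ (assemble (split j l refl)) (∈-cartesianProduct⁺ (∈-filter⁺ Irreducible? y∈ irr) z∈))
                 (∈-map⁺ assembled (∈-splits j l))
      where
      y∈ = proj₁ (⊞-∈⁻ x∈)
      z∈ = proj₂ (⊞-∈⁻ x∈)
      -- A proper cut of `y` would also cut `y ⊞ z`, before its least cut.
      irr : Irreducible y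
      irr i (s≤s i<j) c = first i i<j (CutAt-⊞⁺ (ℕP.m≤n⇒m≤1+n i<j) c)

  assembled-∈ : ∀ {n} {x : A n} → x ∈ L.concatMap assembled (splits n) → x ∈ S n
  assembled-∈ {n} x∈ with ∈-concat⁻′ (L.map assembled (splits n)) x∈
  ... | _ , x∈ₛ , xs∈ with ∈-map⁻ assembled xs∈
  ... | s , _ , refl with ∈-map⁻ (assemble s) x∈ₛ
  ... | p , p∈ , refl = go s p∈
    where
    go : ∀ {n} (s : Split n) {p} → p ∈ components s → assemble s p ∈ S n
    go s@(split k l refl) p∈ = let x∈ , _ , y∈ = components-∈⁻ s p∈ in ⊞-∈⁺ x∈ y∈

  assembled-unique : ∀ n → Unique (L.concatMap assembled (splits n))
  assembled-unique n = UniqueP.concat⁺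
      (AllP.map⁺ (All.universal unique (splits n)))
      (APP.map⁺ (AP.map (λ {s} {t} → disjoint {s} {t}) (splits-sorted n)))
    where
    unique : ∀ s → Unique (assembled s)
    unique s = UniqueP.map⁺ (assemble-injective s)
      (UniqueP.cartesianProduct⁺ (UniqueP.filter⁺ Irreducible? (S-unique (suc (k s)))) (S-unique (l s)))
    disjoint : ∀ {s t} → k s < k t → Disjoint (assembled s) (assembled t)
    disjoint {s} {t} ks<kt (x∈s , x∈t) with ∈-map⁻ (assemble s) x∈s | ∈-map⁻ (assemble t) x∈t
    -- The shorter split `s` cuts the common element inside the first component of `t`, which is
    -- irreducible.
    ... | p , _ , refl | q , q∈ , eq = proj₁ (proj₂ (components-∈⁻ t q∈)) (k s) (s≤s ks<kt)
          (assemble-cut⁻ t q (ℕP.m≤n⇒m≤1+n ks<kt) (subst (λ z → CutAt z (suc (k s))) eq (assemble-cut⁺ s p)))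

  decomposition : ∀ n → S (suc n) ↭ L.concatMap assembled (splits (suc n))
  decomposition n = ∼bag⇒↭ (unique∧set⇒bag (S-unique (suc n)) (assembled-unique (suc n)) (mk⇔ first-cut assembled-∈))

-- Polynomials and the common recursion

module _ {A : Set} {B : Set} where

  concatMap-cong-∈ : {f g : A → List B} → ∀ xs → (∀ {x} → x ∈ xs → f x ≡ g x) → L.concatMap f xs ≡ L.concatMap g xs
  concatMap-cong-∈ []       h = refl
  concatMap-cong-∈ (x ∷ xs) h = cong₂ L._++_ (h (here refl)) (concatMap-cong-∈ xs (h ∘ there))

  concatMap-↭-∈ : {f g : A → List B} → ∀ xs → (∀ {x} → x ∈ xs → f x ↭ g x) → L.concatMap f xs ↭ L.concatMap g xs
  concatMap-↭-∈ []       h = ↭-refl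
  concatMap-↭-∈ (x ∷ xs) h = PermP.++⁺ (h (here refl)) (concatMap-↭-∈ xs (h ∘ there))

  concatMap⁺ : (f : A → List B) → ∀ {xs ys} → xs ↭ ys → L.concatMap f xs ↭ L.concatMap f ys
  concatMap⁺ f Perm↭.refl         = ↭-refl
  concatMap⁺ f (Perm↭.prep x p)   = PermP.++⁺ˡ (f x) (concatMap⁺ f p)
  concatMap⁺ f (Perm↭.swap x y p) = ↭-trans (PermP.shifts (f x) (f y)) (PermP.++⁺ˡ (f y) (PermP.++⁺ˡ (f x) (concatMap⁺ f p)))
  concatMap⁺ f (Perm↭.trans p q)  = ↭-trans (concatMap⁺ f p) (concatMap⁺ f q)

  concatMap-concatMap : {C : Set} (f : B → List C) (g : A → List B) → ∀ xs →
                        L.concatMap f (L.concatMap g xs) ≡ L.concatMap (L.concatMap f ∘ g) xs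
  concatMap-concatMap f g []       = refl
  concatMap-concatMap f g (x ∷ xs) = trans (LP.concatMap-++ f (g x) (L.concatMap g xs))
    (cong (L.concatMap f (g x) L.++_) (concatMap-concatMap f g xs))

  concatMap-filter : {P : A → Set} (P? : ∀ x → Dec (P x)) (f : A → List B) → ∀ xs →
                     L.concatMap (λ x → if does (P? x) then f x else []) xs ≡ L.concatMap f (L.filter P? xs)
  concatMap-filter P? f []       = refl
  concatMap-filter P? f (x ∷ xs) with does (P? x)
  ... | true  = cong (f x L.++_) (concatMap-filter P? f xs)
  ... | false = concatMap-filter P? f xs

  concat-concatMap-map : {C : Set} (h : A × B → List C) → ∀ xs ys →
    L.concat (L.concatMap (λ x → L.map (λ y → h (x , y)) ys) xs) ≡ L.concatMap h (L.cartesianProduct xs ys)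
  concat-concatMap-map h []       ys = refl
  concat-concatMap-map h (x ∷ xs) ys = begin
    L.concat (L.map (λ y → h (x , y)) ys L.++ L.concatMap (λ x → L.map (λ y → h (x , y)) ys) xs)
      ≡⟨ LP.concat-++ (L.map (λ y → h (x , y)) ys) _ ⟨
    L.concatMap (λ y → h (x , y)) ys L.++ L.concat (L.concatMap (λ x → L.map (λ y → h (x , y)) ys) xs)
      ≡⟨ cong₂ L._++_ (sym (LP.concatMap-map h (x ,_) ys)) (concat-concatMap-map h xs ys) ⟩
    L.concatMap h (L.map (x ,_) ys) L.++ L.concatMap h (L.cartesianProduct xs ys)
      ≡⟨ LP.concatMap-++ h (L.map (x ,_) ys) (L.cartesianProduct xs ys) ⟨
    L.concatMap h (L.cartesianProduct (x ∷ xs) ys)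
      ∎
    where open ≡-Reasoning

Monomial : Set
Monomial = ℕ × ℕ × ℕ

infixl 7 _·_
_·_ : Monomial → Monomial → Monomial
(a , b , c) · (a′ , b′ , c′) = a + a′ , b + b′ , c + c′

*ᴾ-concatMap : ∀ p q → p *ᴾ q ≡ L.concatMap (λ s → L.map (s ·_) q) p
*ᴾ-concatMap p q = LP.concatMap-cong (λ { (a , b , c) → LP.map-cong (λ { (a′ , b′ , c′) → refl }) q }) p

*ᴾ-congˡ : ∀ {p p′} q → p ↭ p′ → p *ᴾ q ↭ p′ *ᴾ q
*ᴾ-congˡ {p} {p′} q p↭p′ = begin
  p *ᴾ q                               ≡⟨ *ᴾ-concatMap p q ⟩
  L.concatMap (λ s → L.map (s ·_) q) p  ↭⟨ concatMap⁺ (λ s → L.map (s ·_) q) p↭p′ ⟩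
  L.concatMap (λ s → L.map (s ·_) q) p′ ≡⟨ *ᴾ-concatMap p′ q ⟨
  p′ *ᴾ q                              ∎
  where open PermutationReasoning

*ᴾ-congʳ : ∀ p {q q′} → q ↭ q′ → p *ᴾ q ↭ p *ᴾ q′
*ᴾ-congʳ p {q} {q′} q↭q′ = begin
  p *ᴾ q                               ≡⟨ *ᴾ-concatMap p q ⟩
  L.concatMap (λ s → L.map (s ·_) q) p  ↭⟨ concatMap-↭-∈ p (λ {s} _ → PermP.map⁺ (s ·_) q↭q′) ⟩
  L.concatMap (λ s → L.map (s ·_) q′) p ≡⟨ *ᴾ-concatMap p q′ ⟨
  p *ᴾ q′                              ∎
  where open PermutationReasoning

*ᴾ-zeroʳ : ∀ p → p *ᴾ [] ≡ []
*ᴾ-zeroʳ []      = refl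
*ᴾ-zeroʳ (_ ∷ p) = *ᴾ-zeroʳ p

*ᴾ-distribʳ : ∀ p p′ q → (p L.++ p′) *ᴾ q ≡ p *ᴾ q L.++ p′ *ᴾ q
*ᴾ-distribʳ p p′ q = LP.concatMap-++ _ p p′

*ᴾ-distribˡ : ∀ p q q′ → p *ᴾ (q L.++ q′) ↭ p *ᴾ q L.++ p *ᴾ q′
*ᴾ-distribˡ []      q q′ = ↭-refl
*ᴾ-distribˡ ((a , b , c) ∷ p) q q′ = begin
  L.map f (q L.++ q′) L.++ p *ᴾ (q L.++ q′)
    ↭⟨ PermP.++⁺ (↭-reflexive (LP.map-++ f q q′)) (*ᴾ-distribˡ p q q′) ⟩
  (L.map f q L.++ L.map f q′) L.++ (p *ᴾ q L.++ p *ᴾ q′)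
    ≡⟨ LP.++-assoc (L.map f q) _ _ ⟩
  L.map f q L.++ (L.map f q′ L.++ (p *ᴾ q L.++ p *ᴾ q′))
    ↭⟨ PermP.++⁺ˡ (L.map f q) (PermP.shifts (L.map f q′) (p *ᴾ q)) ⟩
  L.map f q L.++ (p *ᴾ q L.++ (L.map f q′ L.++ p *ᴾ q′))
    ≡⟨ LP.++-assoc (L.map f q) _ _ ⟨
  (L.map f q L.++ p *ᴾ q) L.++ (L.map f q′ L.++ p *ᴾ q′)
    ∎
  where
  open PermutationReasoning
  f : Monomial → Monomial
  f = λ { (a′ , b′ , c′) → (a + a′ , b + b′ , c + c′) }

*ᴾ-concatMapʳ : ∀ {B : Set} p (W : B → Poly) ys → p *ᴾ L.concatMap W ys ↭ L.concatMap (λ y → p *ᴾ W y) ys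
*ᴾ-concatMapʳ p W []       = ↭-reflexive (*ᴾ-zeroʳ p)
*ᴾ-concatMapʳ p W (y ∷ ys) = ↭-trans (*ᴾ-distribˡ p (W y) _) (PermP.++⁺ˡ (p *ᴾ W y) (*ᴾ-concatMapʳ p W ys))

concatMap-*ᴾ : ∀ {A B : Set} (V : A → Poly) (W : B → Poly) xs ys →
  L.concatMap (λ { (x , y) → V x *ᴾ W y }) (L.cartesianProduct xs ys) ↭ L.concatMap V xs *ᴾ L.concatMap W ys
concatMap-*ᴾ V W []       ys = ↭-refl
concatMap-*ᴾ V W (x ∷ xs) ys = begin
  L.concatMap VW (L.map (x ,_) ys L.++ L.cartesianProduct xs ys)
    ≡⟨ LP.concatMap-++ VW (L.map (x ,_) ys) _ ⟩
  L.concatMap VW (L.map (x ,_) ys) L.++ L.concatMap VW (L.cartesianProduct xs ys)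
    ≡⟨ cong (L._++ L.concatMap VW (L.cartesianProduct xs ys)) (LP.concatMap-map VW (x ,_) ys) ⟩
  L.concatMap (λ y → V x *ᴾ W y) ys L.++ L.concatMap VW (L.cartesianProduct xs ys)
    ↭⟨ PermP.++⁺ (↭-sym (*ᴾ-concatMapʳ (V x) W ys)) (concatMap-*ᴾ V W xs ys) ⟩
  V x *ᴾ L.concatMap W ys L.++ L.concatMap V xs *ᴾ L.concatMap W ys
    ≡⟨ *ᴾ-distribʳ (V x) (L.concatMap V xs) (L.concatMap W ys) ⟨
  L.concatMap V (x ∷ xs) *ᴾ L.concatMap W ys
    ∎
  where
  open PermutationReasoning
  VW = λ { (x , y) → V x *ᴾ W y }

module _ (F : Family) where
  open Family F
  open Split

  -- Two weights are needed because the first block of an interval partition contributes a whole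
  -- `κ`, while the remainder carries its block product. For pairs both are `weight`.
  sum-decomposition : (V W : ∀ {n} → A n → Poly) →
    (∀ {k l} {x : A (suc k)} {y : A l} → x ∈ S (suc k) → Irreducible x → y ∈ S l → W (x ⊞ y) ≡ V x *ᴾ W y) →
    ∀ n → L.concatMap W (S (suc n)) ↭
          L.concatMap (λ s → L.concatMap V (irreducibles (suc (k s))) *ᴾ L.concatMap W (S (l s))) (splits (suc n))
  sum-decomposition V W mult n = begin
    L.concatMap W (S (suc n))
      ↭⟨ concatMap⁺ W (decomposition n) ⟩
    L.concatMap W (L.concatMap assembled (splits (suc n)))
      ≡⟨ concatMap-concatMap W assembled (splits (suc n)) ⟩
    L.concatMap (L.concatMap W ∘ assembled) (splits (suc n))
      ↭⟨ concatMap-↭-∈ (splits (suc n)) (λ {s} _ → part s) ⟩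
    _ ∎
    where
    open PermutationReasoning
    factor : ∀ {n} (s : Split n) {p} → p ∈ components s → W (assemble s p) ≡ V (proj₁ p) *ᴾ W (proj₂ p)
    factor s@(split k l refl) p∈ = let x∈ , irr , y∈ = components-∈⁻ s p∈ in mult x∈ irr y∈
    part : ∀ {n} (s : Split n) → L.concatMap W (assembled s) ↭
             L.concatMap V (irreducibles (suc (k s))) *ᴾ L.concatMap W (S (l s))
    part s = begin
      L.concatMap W (assembled s)
        ≡⟨ LP.concatMap-map W (assemble s) (components s) ⟩
      L.concatMap (W ∘ assemble s) (components s)
        ≡⟨ concatMap-cong-∈ (components s) (factor s) ⟩
      L.concatMap (λ { (x , y) → V x *ᴾ W y }) (components s)
        ↭⟨ concatMap-*ᴾ V W (irreducibles (suc (k s))) (S (l s)) ⟩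
      _ ∎

-- The two families: interval partitions and pairs

Int-family : Family
Int-family = record
  { A           = Perm
  ; S           = Int
  ; S-unique    = Lset-unique L-Int
  ; _⊞_         = _⊕_
  ; ⊞-injective = ⊕-injective
  ; ⊞-∈⁺        = λ {_} {_} {x} {y} x∈ y∈ → Lset-∈⁺ L-Int (⊕-InL⁺ x y L-Int (Lset-∈⁻ L-Int x∈) (Lset-∈⁻ L-Int y∈))
  ; ⊞-∈⁻        = λ {_} {_} {x} {y} xy∈ →
      let x∈ , y∈ = ⊕-InL⁻ x y L-Int (Lset-∈⁻ L-Int xy∈) in Lset-∈⁺ L-Int x∈ , Lset-∈⁺ L-Int y∈
  ; CutAt       = Cut
  ; CutAt?      = Cut?
  ; CutAt-end   = Cut-end
  ; CutAt-split = Cut-split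
  ; CutAt-⊞⁺    = λ {_} {_} {_} {x} {y} → Cut-⊕⁺ x y
  ; CutAt-⊞⁻    = λ {_} {_} {_} {x} {y} → Cut-⊕⁻ x y
  }

pairs : LChoice → ∀ n → List (Perm n × Perm n)
pairs c n = L.cartesianProduct (Int n) (Lset c n)

module _ (c : LChoice) where

  pairs-∈⁺ : ∀ {n} {α β : Perm n} → InL L-Int α → InL c β → (α , β) ∈ pairs c n
  pairs-∈⁺ a b = ∈-cartesianProduct⁺ (Lset-∈⁺ L-Int a) (Lset-∈⁺ c b)

  pairs-∈⁻ : ∀ {n} {α β : Perm n} → (α , β) ∈ pairs c n → InL L-Int α × InL c β
  pairs-∈⁻ {n} p∈ = let α∈ , β∈ = ∈-cartesianProduct⁻ (Int n) (Lset c n) p∈ in Lset-∈⁻ L-Int α∈ , Lset-∈⁻ c β∈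

  -- Only common cuts count, so each component of an irreducible pair may still have cuts of its
  -- own.
  pair-family : Family
  pair-family = record
    { A           = λ n → Perm n × Perm n
    ; S           = pairs c
    ; S-unique    = λ n → UniqueP.cartesianProduct⁺ (Lset-unique L-Int n) (Lset-unique c n)
    ; _⊞_         = λ { (α , β) (α′ , β′) → α ⊕ α′ , β ⊕ β′ }
    ; ⊞-injective = λ eq →
        let α≡ , α′≡ = ⊕-injective (cong proj₁ eq)
            β≡ , β′≡ = ⊕-injective (cong proj₂ eq)
        in cong₂ _,_ α≡ β≡ , cong₂ _,_ α′≡ β′≡
    ; ⊞-∈⁺        = λ {_} {_} {(α , β)} {(α′ , β′)} p∈ q∈ →
        let a , b = pairs-∈⁻ p∈ ; a′ , b′ = pairs-∈⁻ q∈
        in pairs-∈⁺ (⊕-InL⁺ α α′ L-Int a a′) (⊕-InL⁺ β β′ c b b′)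
    ; ⊞-∈⁻        = λ {_} {_} {(α , β)} {(α′ , β′)} pq∈ →
        let aa′ , bb′ = pairs-∈⁻ pq∈
            a , a′ = ⊕-InL⁻ α α′ L-Int aa′
            b , b′ = ⊕-InL⁻ β β′ c bb′
        in pairs-∈⁺ a b , pairs-∈⁺ a′ b′
    ; CutAt       = λ { (α , β) j → Cut α j × Cut β j }
    ; CutAt?      = λ { (α , β) j → Cut? α j ×-dec Cut? β j }
    ; CutAt-end   = λ { (α , β) → Cut-end α , Cut-end β }
    ; CutAt-split = λ { (α , β) (cutα , cutβ) →
        let α₁ , α₂ , α≡ = Cut-split α cutα
            β₁ , β₂ , β≡ = Cut-split β cutβ
        in (α₁ , β₁) , (α₂ , β₂) , cong₂ _,_ α≡ β≡ }
    ; CutAt-⊞⁺    = λ {_} {_} {_} {(α , β)} {(α′ , β′)} j≤k (cutα , cutβ) →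
        Cut-⊕⁺ α α′ j≤k cutα , Cut-⊕⁺ β β′ j≤k cutβ
    ; CutAt-⊞⁻    = λ {_} {_} {_} {(α , β)} {(α′ , β′)} j≤k (cutα , cutβ) →
        Cut-⊕⁻ α α′ j≤k cutα , Cut-⊕⁻ β β′ j≤k cutβ
    }

-- Weights of pairs and their behaviour under Kreweras complements

weight : ∀ {n} → Perm n × Perm n → Poly
weight (α , β) = L.[ ‖ inv α ∘ₚ β ‖ , ‖ α ‖ , ‖ β ‖ ]

weight-⊕ : ∀ {k l} (α β : Perm k) (α′ β′ : Perm l) → Inj α → Inj α′ →
           weight (α ⊕ α′ , β ⊕ β′) ≡ weight (α , β) *ᴾ weight (α′ , β′)
weight-⊕ α β α′ β′ α-inj α′-inj = cong L.[_] (cong₂ _,_ quotient (cong₂ _,_ (‖‖-⊕ α α′) (‖‖-⊕ β β′)))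
  where
  quotient : ‖ inv (α ⊕ α′) ∘ₚ (β ⊕ β′) ‖ ≡ ‖ inv α ∘ₚ β ‖ + ‖ inv α′ ∘ₚ β′ ‖
  quotient = trans (cong ‖_‖ (trans (cong (_∘ₚ (β ⊕ β′)) (inv-⊕ α α′ α-inj α′-inj)) (⊕-∘ₚ (inv α) (inv α′) β β′)))
               (‖‖-⊕ (inv α ∘ₚ β) (inv α′ ∘ₚ β′))

module _ {n} {α β : Perm (suc n)} (ncα : IsNCPerm α) (ncβ : IsNCPerm β) where
  private
    module Nα = IsNCPerm ncα
    module Nβ = IsNCPerm ncβ
    Γ = γ (suc n)

  ‖‖-inv : ‖ inv α ‖ ≡ ‖ α ‖
  ‖‖-inv = ‖‖-conj-inv {c = idP (suc n)} (inv-Inj α Nα.injective) Nα.injective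
    (λ {i} {j} eq → trans (sym (VP.lookup∘tabulate id i)) (trans eq (VP.lookup∘tabulate id j)))
    (λ i → trans (cong (α !_) (VP.lookup∘tabulate id _))
       (trans (inv-right α Nα.injective i) (sym (VP.lookup∘tabulate id i))))

  -- The permutation on the left is `γ⁻¹ α γ`, a conjugate of `α` by `γ`.
  ‖‖-Kr-γ : ‖ inv (Kr α) ∘ₚ γ (suc n) ‖ ≡ ‖ α ‖
  ‖‖-Kr-γ = trans (‖‖-conj-inv {c = Γ} (∘ₚ-Inj {α = inv (Kr α)} {Γ} (inv-Inj (Kr α) (Kr-Inj ncα)) γ-Inj)
      (inv-Inj α Nα.injective) γ-Inj conj) ‖‖-inv
    where
    conj : ∀ i → inv α ! (Γ ! ((inv (Kr α) ∘ₚ Γ) ! i)) ≡ Γ ! i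
    conj i = begin
      inv α ! (Γ ! ((inv (Kr α) ∘ₚ Γ) ! i)) ≡⟨ !-∘ₚ (inv α) Γ ((inv (Kr α) ∘ₚ Γ) ! i) ⟨
      Kr α ! ((inv (Kr α) ∘ₚ Γ) ! i)        ≡⟨ cong (Kr α !_) (!-∘ₚ (inv (Kr α)) Γ i) ⟩
      Kr α ! (inv (Kr α) ! (Γ ! i))         ≡⟨ inv-right (Kr α) (Kr-Inj ncα) (Γ ! i) ⟩
      Γ ! i                                 ∎
      where open ≡-Reasoning

  -- Conjugating `(Kr α)⁻¹ (Kr β)` by `Kr α` gives `(Kr β)(Kr α)⁻¹ = β⁻¹ α`, the inverse of `α⁻¹ β`.
  -- This is why the conjugation lemma has an inverse built in.
  ‖‖-Kr-Kr : ‖ inv (Kr α) ∘ₚ Kr β ‖ ≡ ‖ inv α ∘ₚ β ‖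
  ‖‖-Kr-Kr = ‖‖-conj-inv {c = Kr α} (∘ₚ-Inj {α = inv (Kr α)} {Kr β} (inv-Inj (Kr α) (Kr-Inj ncα)) (Kr-Inj ncβ))
      (∘ₚ-Inj {α = inv α} {β} (inv-Inj α Nα.injective) Nβ.injective) (Kr-Inj ncα) conj
    where
    conj : ∀ i → (inv α ∘ₚ β) ! (Kr α ! ((inv (Kr α) ∘ₚ Kr β) ! i)) ≡ Kr α ! i
    conj i = begin
      (inv α ∘ₚ β) ! (Kr α ! ((inv (Kr α) ∘ₚ Kr β) ! i)) ≡⟨ !-∘ₚ (inv α) β (Kr α ! ((inv (Kr α) ∘ₚ Kr β) ! i)) ⟩
      inv α ! (β ! (Kr α ! ((inv (Kr α) ∘ₚ Kr β) ! i)))  ≡⟨ cong (λ z → inv α ! (β ! (Kr α ! z))) (!-∘ₚ (inv (Kr α)) (Kr β) i) ⟩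
      inv α ! (β ! (Kr α ! (inv (Kr α) ! (Kr β ! i))))   ≡⟨ cong (λ z → inv α ! (β ! z)) (inv-right (Kr α) (Kr-Inj ncα) (Kr β ! i)) ⟩
      inv α ! (β ! (Kr β ! i))                           ≡⟨ cong (inv α !_) (α-Kr ncβ i) ⟩
      inv α ! (Γ ! i)                                    ≡⟨ !-∘ₚ (inv α) Γ i ⟨
      Kr α ! i                                           ∎
      where open ≡-Reasoning

Kr-weight : ∀ {n} → Perm n × Perm n → Poly
Kr-weight {n} (α , β) = L.[ ‖ inv α ∘ₚ β ‖ , ‖ inv α ∘ₚ γ n ‖ , ‖ inv β ∘ₚ γ n ‖ ]

Kr-weight-Kr : ∀ {n} {α β : Perm (suc n)} → IsNCPerm α → IsNCPerm β → Kr-weight (Kr α , Kr β) ≡ weight (α , β)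
Kr-weight-Kr ncα ncβ = cong L.[_] (cong₂ _,_ (‖‖-Kr-Kr ncα ncβ) (cong₂ _,_ (‖‖-Kr-γ ncα ncα) (‖‖-Kr-γ ncβ ncβ)))

m-pairs : ∀ c n → m c n ≡ L.concatMap weight (pairs c n)
m-pairs c n = concat-concatMap-map weight (Int n) (Lset c n)

-- `KrInt` and `KrL` are lists of images under `Kr`, so the sum is reindexed term by term and the
-- two sides are equal as lists.
κ-irreducibles : ∀ c n → κ c (suc n) ≡ L.concatMap weight (Family.irreducibles (pair-family c) (suc n))
κ-irreducibles c n = begin
  κ c (suc n)
    ≡⟨ cong L.concat (LP.concatMap-map (λ α → L.map (λ β → term α β) (KrL c (suc n))) Kr (Int (suc n))) ⟩
  L.concat (L.concatMap (λ α → L.map (λ β → term (Kr α) β) (L.map Kr (Lset c (suc n)))) (Int (suc n)))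
    ≡⟨ cong L.concat (LP.concatMap-cong (λ α → sym (LP.map-∘ (Lset c (suc n)))) (Int (suc n))) ⟩
  L.concat (L.concatMap (λ α → L.map (λ β → term (Kr α) (Kr β)) (Lset c (suc n))) (Int (suc n)))
    ≡⟨ concat-concatMap-map (λ { (α , β) → term (Kr α) (Kr β) }) (Int (suc n)) (Lset c (suc n)) ⟩
  L.concatMap (λ { (α , β) → term (Kr α) (Kr β) }) (pairs c (suc n))
    ≡⟨ concatMap-cong-∈ (pairs c (suc n)) same ⟩
  L.concatMap (λ p → if does (Fam.Irreducible? p) then weight p else []) (pairs c (suc n))
    ≡⟨ concatMap-filter Fam.Irreducible? weight (pairs c (suc n)) ⟩
  L.concatMap weight (Fam.irreducibles (suc n))
    ∎
  where
  open ≡-Reasoning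
  module Fam = Family (pair-family c)
  term : Perm (suc n) → Perm (suc n) → Poly
  term α β = if meetKrIntIsZero α β then Kr-weight (α , β) else []
  same : ∀ {p} → p ∈ pairs c (suc n) →
         term (Kr (proj₁ p)) (Kr (proj₂ p)) ≡ (if does (Fam.Irreducible? p) then weight p else [])
  same {α , β} p∈ = cong₂ (λ b w → if b then w else []) (decide (Fam.Irreducible? (α , β))) (Kr-weight-Kr ncα ncβ)
    where
    ncα = proj₁ (proj₁ (pairs-∈⁻ c p∈))
    ncβ = InL⇒NC c (proj₂ (pairs-∈⁻ c p∈))
    -- Stated for an arbitrary decision `d`, so that matching on it makes `does d` reduce.
    decide : (d : Dec (NoCommonCut α β)) → meetKrIntIsZero (Kr α) (Kr β) ≡ does d
    decide (yes none) = T-ext _ (λ _ → noCommonCut⇒meet ncα ncβ none)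
    decide (no some)  = T-ext (λ t → some (meet⇒noCommonCut ncα ncβ t)) λ ()

m-recursion : ∀ c n → m c (suc n) ↭ L.concatMap (λ s → κ c (suc (Split.k s)) *ᴾ m c (Split.l s)) (splits (suc n))
m-recursion c n = begin
  m c (suc n)
    ≡⟨ m-pairs c (suc n) ⟩
  L.concatMap weight (pairs c (suc n))
    ↭⟨ sum-decomposition (pair-family c) weight weight mult n ⟩
  _
    ≡⟨ LP.concatMap-cong (λ s → cong₂ _*ᴾ_ (κ-irreducibles c (Split.k s)) (m-pairs c (Split.l s))) (splits (suc n)) ⟨
  _ ∎
  where
  open PermutationReasoning
  mult : ∀ {k l} {x : Perm (suc k) × Perm (suc k)} {y : Perm l × Perm l} → x ∈ pairs c (suc k) →
         NoCommonCut (proj₁ x) (proj₂ x) → y ∈ pairs c l → _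
  mult {x = α , β} {α′ , β′} x∈ _ y∈ = weight-⊕ α β α′ β′
    (IsNCPerm.injective (proj₁ (proj₁ (pairs-∈⁻ c x∈)))) (IsNCPerm.injective (proj₁ (proj₁ (pairs-∈⁻ c y∈))))

-- Block products over interval partitions

countF-all : ∀ {n} {p : Fin n → Bool} → (∀ i → T (p i)) → countF p ≡ n
countF-all {n} {p} h = trans (cong length (LP.filter-all (T? ∘ p) (All.universal h (allFin n)))) (LP.length-tabulate {n = n} id)

countF-none : ∀ {n} {p : Fin n → Bool} → (∀ i → ¬ T (p i)) → countF p ≡ 0
countF-none {n} {p} h = cong length (LP.filter-none (T? ∘ p) (All.universal h (allFin n)))

cycleMins-γ : ∀ n → filterᵇ (isCycleMin (γ (suc n))) (allFin (suc n)) ≡ zero ∷ []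
cycleMins-γ n = trans
    (LP.filter-accept (T? ∘ isCycleMin Γ) {zero} {L.tabulate suc} (isCycleMin-intro Γ λ j _ → z≤n))
    (cong (zero ∷_) (LP.filter-none (T? ∘ isCycleMin Γ) (AllP.tabulate⁺ λ i t →
      ℕP.n≮0 (isCycleMin-elim Γ {suc i} {zero} t (γ-reach (suc i) zero)))))
  where
  Γ = γ (suc n)

-- Blocks are listed by increasing minima, so the block of `zero` comes first; cycles stay within
-- their summand, which preserves the sizes.
blockSizes-γ⊕ : ∀ k {l} (σ : Perm l) → blockSizes (γ (suc k) ⊕ σ) ≡ suc k ∷ blockSizes σ
blockSizes-γ⊕ k {l} σ = begin
  L.map size (filterᵇ (isCycleMin π) (allFin (suc k + l)))
    ≡⟨ cong (L.map size) (filterᵇ-allFin-+ (suc k) l (isCycleMin π)) ⟩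
  L.map size (L.map (_↑ˡ l) (filterᵇ (isCycleMin π ∘ (_↑ˡ l)) (allFin (suc k)))
         L.++ L.map (suc k ↑ʳ_) (filterᵇ (isCycleMin π ∘ (suc k ↑ʳ_)) (allFin l)))
    ≡⟨ cong₂ (λ xs ys → L.map size (L.map (_↑ˡ l) xs L.++ L.map (suc k ↑ʳ_) ys))
         (trans (filterᵇ-cong (Embed.isCycleMin-e (embedˡ Γ σ)) (allFin (suc k))) (cycleMins-γ k))
         (filterᵇ-cong (Embed.isCycleMin-e (embedʳ Γ σ)) (allFin l)) ⟩
  size (zero ↑ˡ l) ∷ L.map size (L.map (suc k ↑ʳ_) mins)
    ≡⟨ cong₂ _∷_ size-ˡ (sym (LP.map-∘ mins)) ⟩
  suc k ∷ L.map (size ∘ (suc k ↑ʳ_)) mins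
    ≡⟨ cong (suc k ∷_) (LP.map-cong size-ʳ mins) ⟩
  suc k ∷ blockSizes σ
    ∎
  where
  open ≡-Reasoning
  Γ = γ (suc k)
  π = Γ ⊕ σ
  mins = filterᵇ (isCycleMin σ) (allFin l)
  size : Fin (suc k + l) → ℕ
  size i = countF (sameCycle π i)
  ˡ-inside : ∀ i → T (sameCycle π (zero ↑ˡ l) (i ↑ˡ l))
  ˡ-inside i = sameCycle-intro π (Embed.reach⁺ (embedˡ Γ σ) (γ-reach zero i))
  ˡ-outside : ∀ j → ¬ T (sameCycle π (zero ↑ˡ l) (suc k ↑ʳ j))
  ˡ-outside j t = let _ , eq , _ = Embed.reach-image (embedˡ Γ σ) (sameCycle-elim π {zero ↑ˡ l} {suc k ↑ʳ j} t)
                  in ˡ≢ʳ Γ σ (sym eq)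
  ʳ-outside : ∀ j i → ¬ T (sameCycle π (suc k ↑ʳ j) (i ↑ˡ l))
  ʳ-outside j i t = let _ , eq , _ = Embed.reach-image (embedʳ Γ σ) (sameCycle-elim π {suc k ↑ʳ j} {i ↑ˡ l} t)
                    in ˡ≢ʳ Γ σ eq
  size-ˡ : size (zero ↑ˡ l) ≡ suc k
  size-ˡ = trans (countF-+ (suc k) l (sameCycle π (zero ↑ˡ l))) (trans
    (cong₂ _+_ (countF-all {p = sameCycle π (zero ↑ˡ l) ∘ (_↑ˡ l)} ˡ-inside)
               (countF-none {p = sameCycle π (zero ↑ˡ l) ∘ (suc k ↑ʳ_)} ˡ-outside))
    (ℕP.+-identityʳ (suc k)))
  size-ʳ : ∀ j → size (suc k ↑ʳ j) ≡ countF (sameCycle σ j)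
  size-ʳ j = trans (countF-+ (suc k) l (sameCycle π (suc k ↑ʳ j))) (cong₂ _+_
    (countF-none {p = sameCycle π (suc k ↑ʳ j) ∘ (_↑ˡ l)} (ʳ-outside j))
    (countF-cong (Embed.sameCycle-e (embedʳ Γ σ) j)))

-- The orbit of `zero` under `γ` reaches the last point and so leaves every proper initial segment;
-- the other inclusion is `Irr-Int⇒γ`.
irreducibles-Int : ∀ n → Family.irreducibles Int-family (suc n) ↭ γ (suc n) ∷ []
irreducibles-Int n = ∼bag⇒↭ (unique∧set⇒bag (UniqueP.filter⁺ Fam.Irreducible? (Lset-unique L-Int (suc n))) ([] ∷ [])
    (mk⇔ to from))
  where
  module Fam = Family Int-family
  to : ∀ {α} → α ∈ Fam.irreducibles (suc n) → α ∈ γ (suc n) ∷ []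
  to α∈ = let α∈Int , irr = ∈-filter⁻ Fam.Irreducible? {xs = Int (suc n)} α∈
          in here (Irr-Int⇒γ (Lset-∈⁻ L-Int α∈Int) irr)
  from : ∀ {α} → α ∈ γ (suc n) ∷ [] → α ∈ Fam.irreducibles (suc n)
  from (here refl) = ∈-filter⁺ Fam.Irreducible? (Lset-∈⁺ L-Int (γ-InL L-Int)) γ-irr
    where
    γ-irr : Irr (γ (suc n))
    γ-irr j j<n cut = ℕP.<⇒≱ (ℕ.s≤s⁻¹ j<n) (subst (_≤ j) (FP.toℕ-fromℕ n)
      (ℕ.s≤s⁻¹ (Cut-reach⁺ {α = γ (suc n)} cut (γ-reach zero (fromℕ n)) (s≤s z≤n))))

module _ (c : LChoice) where

  blockProduct : ∀ {n} → Perm n → Poly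
  blockProduct σ = prodᴾ (L.map (κ c) (blockSizes σ))

  booleanRHS-recursion : ∀ n → booleanRHS c (suc n) ↭
    L.concatMap (λ s → κ c (suc (Split.k s)) *ᴾ booleanRHS c (Split.l s)) (splits (suc n))
  -- The first component is weighted by `κ` of its size alone; as there is one irreducible per size,
  -- `once` reduces the inner sum to a single `κ`.
  booleanRHS-recursion n = ↭-trans (sum-decomposition Int-family (λ {n} _ → κ c n) blockProduct mult n)
    (concatMap-↭-∈ (splits (suc n)) λ {s} _ → *ᴾ-congˡ (booleanRHS c (Split.l s)) (once (Split.k s)))
    where
    mult : ∀ {k l} {σ : Perm (suc k)} {τ : Perm l} → σ ∈ Int (suc k) → Irr σ → τ ∈ Int l →
           blockProduct (σ ⊕ τ) ≡ κ c (suc k) *ᴾ blockProduct τ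
    mult {k} {τ = τ} σ∈ irr _ = cong (prodᴾ ∘ L.map (κ c))
      (trans (cong (λ σ → blockSizes (σ ⊕ τ)) (Irr-Int⇒γ (Lset-∈⁻ L-Int σ∈) irr)) (blockSizes-γ⊕ k τ))
    once : ∀ k → L.concatMap (λ _ → κ c (suc k)) (Family.irreducibles Int-family (suc k)) ↭ κ c (suc k)
    once k = ↭-trans (concatMap⁺ (λ _ → κ c (suc k)) (irreducibles-Int k)) (↭-reflexive (LP.++-identityʳ (κ c (suc k))))

  -- The remainder after the first cut may be empty, so the recursion descends to size `0`, where
  -- both sides compute to the constant `1`.
  m-zero : m c 0 ↭ booleanRHS c 0
  m-zero = go c
    where
    go : ∀ c → m c 0 ↭ booleanRHS c 0
    go L-NC  = ↭-refl
    go L-Int = ↭-refl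

  m↭booleanRHS : ∀ n → m c n ↭ booleanRHS c n
  m↭booleanRHS = <-rec _ λ { zero _ → m-zero ; (suc n) rec → step n rec }
    where
    step : ∀ n → (∀ {l} → l < suc n → m c l ↭ booleanRHS c l) → m c (suc n) ↭ booleanRHS c (suc n)
    step n rec = ↭-trans (m-recursion c n) (↭-trans
      (concatMap-↭-∈ (splits (suc n)) λ {s} _ → *ᴾ-congʳ (κ c (suc (Split.k s))) (rec (smaller s)))
      (↭-sym (booleanRHS-recursion n)))
      where
      smaller : (s : Split (suc n)) → Split.l s < suc n
      smaller s = subst (Split.l s <_) (Split.eq s) (s≤s (ℕP.m≤n+m (Split.l s) (Split.k s)))

theorem3p8 : (c : LChoice) (n : ℕ) → 1 ≤ n → m c n ↭ booleanRHS c n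
theorem3p8 c n _ = m↭booleanRHS c n
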